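{- Let $G$ be a signed eulerian graph with an odd number of negative edges. The following are equivalent: (a) $G$ admits a nowhere-zero integer flow; (b) $G$ admits a nowhere-zero $4$-flow; (c) $G$ contains two edge-disjoint unbalanced circuits; (d) $G$ is the union of two eulerian subgraphs each having an even number of negative edges; (e) $G$ can be decomposed into three edge-disjoint eulerian subgraphs each having an odd number of negative edges.
   Context: Graphs are finite and may have loops and multiple edges. A graph is eulerian if it is connected and every vertex has even valency. A signed graph is a graph with a signature $\sigma:E\to\{+1,-1\}$; a circuit (connected 2-regular subgraph) is unbalanced if it contains an odd number of negative edges. Orientation: each edge has two half-edges; positive edges have exactly one half-edge pointing toward its end, negative edges have both pointing away or both toward their ends. A $\mathbb{Z}$-flow is $\xi:E\to\mathbb{Z}$ such that at each vertex the sum of values on half-edges directed out minus the sum on half-edges directed in is $0$; nowhere-zero means no value $0$; a nowhere-zero $k$-flow takes values in $\{\pm1,\dots,\pm(k-1)\}$. -}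

module Defs where

open import Data.Nat using (ℕ; zero; suc; _+_; _<_)
open import Data.Nat.Divisibility using (_∣_)
open import Data.Integer as ℤ using (ℤ; +_; -_; ∣_∣)
open import Data.Bool using (Bool; true; false; if_then_else_)
open import Data.Fin using (Fin; zero; suc; _≟_)
open import Data.Product using (Σ; _×_; _,_)
open import Data.Sum using (_⊎_)
open import Relation.Nullary using (¬_; does)
open import Relation.Binary.PropositionalEquality using (_≡_; _≢_)
open import Function.Bundles using (_⇔_)

-- A finite graph (loops and parallel edges allowed) with a signature.
-- Edges are Fin nE; each edge has two half-edges, indexed by Fin 2;
-- end e i is the vertex to which half-edge i of e is attached.
-- neg e = true iff σ(e) = -1.
record SignedGraph : Set where
  field
    nV   : ℕ
    nE   : ℕ
    end  : Fin nE → Fin 2 → Fin nV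
    neg  : Fin nE → Bool

sumℕ : ∀ {m} → (Fin m → ℕ) → ℕ
sumℕ {zero}  f = 0
sumℕ {suc m} f = f zero + sumℕ (λ i → f (suc i))

sumℤ : ∀ {m} → (Fin m → ℤ) → ℤ
sumℤ {zero}  f = + 0
sumℤ {suc m} f = f zero ℤ.+ sumℤ (λ i → f (suc i))

count : ∀ {m} → (Fin m → Bool) → ℕ
count p = sumℕ (λ i → if p i then 1 else 0)

Even Odd : ℕ → Set
Even n = 2 ∣ n
Odd n = ¬ (2 ∣ n)

module _ (G : SignedGraph) where
  open SignedGraph G

  -- A subgraph is given by its edge set (its vertices are the ends of its edges).
  EdgeSet : Set
  EdgeSet = Fin nE → Bool

  allEdges : EdgeSet
  allEdges _ = true

  -- valency of v in the subgraph S (a loop contributes 2)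
  deg : EdgeSet → Fin nV → ℕ
  deg S v = sumℕ (λ e → if S e then sumℕ (λ i → if does (end e i ≟ v) then 1 else 0) else 0)

  negCount : EdgeSet → ℕ
  negCount S = count (λ e → if S e then neg e else false)

  data Reach (S : EdgeSet) (u : Fin nV) : Fin nV → Set where
    here : Reach S u u
    step : ∀ {e} (i j : Fin 2) → S e ≡ true → Reach S u (end e i) → Reach S u (end e j)

  Incident : EdgeSet → Fin nV → Set
  Incident S v = Σ (Fin nE) λ e → Σ (Fin 2) λ i → S e ≡ true × end e i ≡ v

  ConnectedSub : EdgeSet → Set
  ConnectedSub S = ∀ u v → Incident S u → Incident S v → Reach S u v

  EulerianGraph : Set
  EulerianGraph = (∀ u v → Reach allEdges u v) × (∀ v → Even (deg allEdges v))

  EulerianSub : EdgeSet → Set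
  EulerianSub S = ConnectedSub S × (∀ v → Even (deg S v))

  Circuit : EdgeSet → Set
  Circuit C = (Σ (Fin nE) λ e → C e ≡ true)
            × (∀ v → deg C v ≡ 0 ⊎ deg C v ≡ 2)
            × ConnectedSub C

  Unbalanced : EdgeSet → Set
  Unbalanced C = Odd (negCount C)

  -- orientation: out e i = true iff half-edge i of e is directed out of its end.
  -- positive edge: exactly one half-edge points toward its end;
  -- negative edge: both point away or both toward.
  Orientation : Set
  Orientation = Fin nE → Fin 2 → Bool

  ValidOrientation : Orientation → Set
  ValidOrientation τ = ∀ e → if neg e then τ e zero ≡ τ e (suc zero)
                                     else τ e zero ≢ τ e (suc zero)

  netFlow : Orientation → (Fin nE → ℤ) → Fin nV → ℤ
  netFlow τ ξ v = sumℤ (λ e → sumℤ (λ i →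
      if does (end e i ≟ v) then (if τ e i then ξ e else - ξ e) else + 0))

  IsFlow : Orientation → (Fin nE → ℤ) → Set
  IsFlow τ ξ = ∀ v → netFlow τ ξ v ≡ + 0

  HasNZFlow : Set
  HasNZFlow = Σ Orientation λ τ → ValidOrientation τ × Σ (Fin nE → ℤ) λ ξ →
                IsFlow τ ξ × (∀ e → ξ e ≢ + 0)

  HasNZkFlow : ℕ → Set
  HasNZkFlow k = Σ Orientation λ τ → ValidOrientation τ × Σ (Fin nE → ℤ) λ ξ →
                IsFlow τ ξ × (∀ e → ξ e ≢ + 0 × ∣ ξ e ∣ < k)

  TwoDisjointUnbalancedCircuits : Set
  TwoDisjointUnbalancedCircuits = Σ EdgeSet λ C₁ → Σ EdgeSet λ C₂ →
    Circuit C₁ × Circuit C₂ × Unbalanced C₁ × Unbalanced C₂ ×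
    (∀ e → C₁ e ≡ true → C₂ e ≡ false)

  UnionTwoEvenEulerian : Set
  UnionTwoEvenEulerian = Σ EdgeSet λ H₁ → Σ EdgeSet λ H₂ →
    EulerianSub H₁ × EulerianSub H₂ × Even (negCount H₁) × Even (negCount H₂) ×
    (∀ e → H₁ e ≡ true ⊎ H₂ e ≡ true)

  DecompThreeOddEulerian : Set
  DecompThreeOddEulerian = Σ EdgeSet λ H₁ → Σ EdgeSet λ H₂ → Σ EdgeSet λ H₃ →
    EulerianSub H₁ × EulerianSub H₂ × EulerianSub H₃ ×
    Odd (negCount H₁) × Odd (negCount H₂) × Odd (negCount H₃) ×
    (∀ e → (H₁ e ≡ true × H₂ e ≡ false × H₃ e ≡ false)
         ⊎ (H₁ e ≡ false × H₂ e ≡ true × H₃ e ≡ false)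
         ⊎ (H₁ e ≡ false × H₂ e ≡ false × H₃ e ≡ true))

{-# OPTIONS --safe #-}

-- (a) ⇒ (c).  For a switching p : V → ±1, summing the net flow against p leaves ± 2 ξ(e) for each
-- edge e that is negative after the switching.  So if G has a nowhere-zero flow, no switching leaves
-- exactly one negative edge, and this property, together with evenness and oddness, yields two
-- disjoint odd cycles (edge sets with all degrees even and an odd number of negative edges) by
-- induction on the number of non-loops: replace two edges e = vx and f = vy by one edge xy.  If this
-- destroys the property, then some switching of G has negative edges a, e, f.  If that happens for
-- all pairs at v, then combining the switchings of several pairs (three of them by a pointwise
-- majority vote) yields a single negative edge after all.
-- (c) ⇒ (e).  For disjoint unbalanced circuits C₁ and C₂, let K be the component of G \ C₁ that
-- contains C₂.  If K is odd, then G \ C₁ has another odd component K′, and G splits into K, K′ and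
-- the rest, which is held together by C₁.  If K is even, then K \ C₂ has an odd component B, and G
-- splits into B, K \ B and G \ K.
-- (e) ⇒ (d).  One of the three parts touches the other two; join it to either of them.
-- (d) ⇒ (c).  G \ H₁ and G \ H₂ are disjoint odd cycles.
-- (d) ⇒ (b).  Alternating along Euler trails gives ± 1 flows ξ₁ on H₁ and ξ₂ on H₂; take ξ₁ + 2 ξ₂.
module Submission where

open import Defs
open import Algebra.Bundles using (CommutativeMonoid; CommutativeRing)
import Algebra.Properties.CommutativeMonoid.Sum as MonoidSum
import Algebra.Properties.CommutativeSemigroup as Semigroup
import Algebra.Properties.Semiring.Sum as SemiringSum
open import Data.Bool using (Bool; true; false; not; _∧_; _∨_; _xor_; if_then_else_)
import Data.Bool.Properties as Bool
open import Data.Empty using (⊥; ⊥-elim)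
open import Data.Fin using (Fin; zero; suc; _≟_)
open import Data.Fin.Properties using (any?; all?; ¬∀⟶∃¬)
open import Data.Fin.Subset.Properties using (anySubset?)
open import Data.Integer as ℤ using (ℤ; +_; -[1+_]; -_; ∣_∣; 0ℤ; 1ℤ; -1ℤ)
import Data.Integer.Properties as ℤ
open import Data.Nat as ℕ using (ℕ; zero; suc; _<_; _≤_; z≤n; s≤s)
open import Data.Nat.Divisibility using (divides)
import Data.Nat.Properties as ℕ
open import Data.Product using (Σ; ∃; _×_; _,_; proj₁; proj₂)
open import Data.Sum using (_⊎_; inj₁; inj₂)
import Data.Vec as Vec
import Data.Vec.Properties as Vec
open import Function using (_∘_)
open import Function.Bundles using (_⇔_; mk⇔)
open import Relation.Binary.PropositionalEquality
open import Relation.Nullary using (¬_; Dec; yes; no; does; contradiction)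
open import Relation.Nullary.Decidable using (¬?; dec-true; dec-false; map′; _×-dec_; _⊎-dec_)

-- Finite sums, over a commutative monoid and over the field with two elements

module SumSingle {c ℓ} (M : CommutativeMonoid c ℓ) where
  open CommutativeMonoid M using (Carrier; _≈_; ε; ∙-cong; ∙-congˡ; identityˡ; identityʳ)
    renaming (trans to ≈-trans)
  open MonoidSum M using (sum; sum-cong-≋; sum-replicate-zero)

  sum-zero : ∀ {m} (f : Fin m → Carrier) → (∀ x → f x ≈ ε) → sum f ≈ ε
  sum-zero {m} f f≈ε = ≈-trans (sum-cong-≋ f≈ε) (sum-replicate-zero m)

  sum-single : ∀ {m} (f : Fin m → Carrier) a → (∀ x → a ≢ x → f x ≈ ε) → sum f ≈ f a
  sum-single f zero f≈ε =
    ≈-trans (∙-congˡ (sum-zero (f ∘ suc) (λ x → f≈ε (suc x) (λ ())))) (identityʳ _)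
  sum-single f (suc a) f≈ε =
    ≈-trans (∙-cong (f≈ε zero (λ ()))
                    (sum-single (f ∘ suc) a (λ x a≢x → f≈ε (suc x) (λ { refl → a≢x refl }))))
            (identityˡ _)

open SemiringSum (CommutativeRing.semiring Bool.xor-∧-commutativeRing)
  using () renaming
  ( sum to ⨁; sum-cong-≗ to ⨁-cong; ∑-distrib-+ to ⨁-xor; ∑-comm to ⨁-comm
  ; *-distribˡ-sum to ⨁-∧ )

open SumSingle (CommutativeRing.+-commutativeMonoid Bool.xor-∧-commutativeRing)
  using () renaming (sum-zero to ⨁-zero; sum-single to ⨁-single)

-- Boolean identities by truth tables

Operation : ℕ → Set
Operation zero    = Bool
Operation (suc n) = Bool → Operation n

Agree : ∀ n → Operation n → Operation n → Set
Agree zero    x y = x ≡ y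
Agree (suc n) f g = ∀ b → Agree n (f b) (g b)

agree : ∀ n → Operation n → Operation n → Bool
agree zero    x y = not (x xor y)
agree (suc n) f g = agree n (f false) (g false) ∧ agree n (f true) (g true)

-- Proof by truth table: `agree` evaluates both operations on all inputs, so for closed operations
-- the last hypothesis is `refl`.
taut : ∀ n (f g : Operation n) → agree n f g ≡ true → Agree n f g
taut zero true  true  _ = refl
taut zero false false _ = refl
taut (suc n) f g eq b with agree n (f false) (g false) in eq₀
taut (suc n) f g eq false | true = taut n (f false) (g false) eq₀
taut (suc n) f g eq true  | true = taut n (f true) (g true) eq

-- Indicators, counting and the majority vote

infix 7 _==_

_==_ : ∀ {m} → Fin m → Fin m → Bool
i == j = does (i ≟ j)

==-refl : ∀ {m} (i : Fin m) → i == i ≡ true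
==-refl i = dec-true (i ≟ i) refl

==-≢ : ∀ {m} {i j : Fin m} → i ≢ j → i == j ≡ false
==-≢ {i = i} {j} = dec-false (i ≟ j)

==-true : ∀ {m} {i j : Fin m} → i == j ≡ true → i ≡ j
==-true {i = i} {j} eq with i ≟ j
... | yes i≡j = i≡j

true≢false : ∀ {b} → b ≡ true → b ≢ false
true≢false refl ()

≢false⇒true : ∀ {b} → b ≢ false → b ≡ true
≢false⇒true {true}  _ = refl
≢false⇒true {false} f = contradiction refl f

∧-true : ∀ {x y} → x ∧ y ≡ true → x ≡ true × y ≡ true
∧-true {true} y≡true = refl , y≡true

⨁-indicator : ∀ {m} c (a : Fin m) → ⨁ (λ x → c ∧ a == x) ≡ c
⨁-indicator c a =
  trans (⨁-single (λ x → c ∧ a == x) a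
          (λ x a≢x → trans (cong (c ∧_) (==-≢ a≢x)) (Bool.∧-zeroʳ c)))
        (trans (cong (c ∧_) (==-refl a)) (Bool.∧-identityʳ c))

⨁-point : ∀ {m} (a : Fin m) → ⨁ (a ==_) ≡ true
⨁-point = ⨁-indicator true

⨁-evaluate : ∀ {m} (p : Fin m → Bool) a → ⨁ (λ x → p x ∧ a == x) ≡ p a
⨁-evaluate p a =
  trans (⨁-single (λ x → p x ∧ a == x) a
          (λ x a≢x → trans (cong (p x ∧_) (==-≢ a≢x)) (Bool.∧-zeroʳ (p x))))
        (trans (cong (p a ∧_) (==-refl a)) (Bool.∧-identityʳ (p a)))

-- Turns a parity argument into a witness; with `g` constantly `false` it picks an element of a set
-- of odd size.
⨁-differ : ∀ {m} (f g : Fin m → Bool) → ⨁ f ≢ ⨁ g → Σ (Fin m) λ x → f x ≢ g x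
⨁-differ {m} f g f≢g = ¬∀⟶∃¬ m _ (λ x → f x Bool.≟ g x) (λ f≗g → f≢g (⨁-cong f≗g))

if-1-0-mono : ∀ {p q} → (p ≡ true → q ≡ true) → (if p then 1 else 0) ≤ (if q then 1 else 0)
if-1-0-mono {false} _   = z≤n
if-1-0-mono {true}  p⇒q rewrite p⇒q refl = s≤s z≤n

count-mono : ∀ {m} {p q : Fin m → Bool} → (∀ x → p x ≡ true → q x ≡ true) → count p ≤ count q
count-mono {zero}  p⇒q = z≤n
count-mono {suc m} p⇒q = ℕ.+-mono-≤ (if-1-0-mono (p⇒q zero)) (count-mono (p⇒q ∘ suc))

count-strict : ∀ {m} {p q : Fin m → Bool} → (∀ x → p x ≡ true → q x ≡ true) →
               ∀ a → p a ≡ false → q a ≡ true → count p < count q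
count-strict p⇒q zero    pa qa rewrite pa | qa = s≤s (count-mono (p⇒q ∘ suc))
count-strict p⇒q (suc a) pa qa =
  ℕ.+-mono-≤-< (if-1-0-mono (p⇒q zero)) (count-strict (p⇒q ∘ suc) a pa qa)

-- Predicates are enumerated as vectors of bits; the first hypothesis stands in for function
-- extensionality when a function is exchanged for its tabulated copy.
anyFunction? : ∀ {k ℓ} {P : (Fin k → Bool) → Set ℓ} → (∀ {p q} → p ≗ q → P p → P q) →
               (∀ p → Dec (P p)) → Dec (∃ P)
anyFunction? resp P? =
  map′ (λ (s , Ps) → Vec.lookup s , Ps)
       (λ (p , Pp) → Vec.tabulate p , resp (sym ∘ Vec.lookup∘tabulate p) Pp)
       (anySubset? (λ s → P? (Vec.lookup s)))

-- The majority vote as a polynomial modulo 2.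
maj : Bool → Bool → Bool → Bool
maj x y z = (x ∧ y) xor (x ∧ z) xor (y ∧ z)

maj-cong : ∀ {x x′ y y′ z z′} → x ≡ x′ → y ≡ y′ → z ≡ z′ → maj x y z ≡ maj x′ y′ z′
maj-cong refl refl refl = refl

-- Self-duality of the majority vote; it moves the sign of an edge through the vote in
-- `three-star-edges`.
maj-dual : ∀ n x y z → maj (n xor x) (n xor y) (n xor z) ≡ n xor maj x y z
maj-dual = taut 4 (λ n x y z → maj (n xor x) (n xor y) (n xor z)) (λ n x y z → n xor maj x y z) refl

xor-interchange : ∀ x y z w → (x xor y) xor (z xor w) ≡ (x xor z) xor (y xor w)
xor-interchange = taut 4 (λ x y z w → (x xor y) xor (z xor w))
                         (λ x y z w → (x xor z) xor (y xor w)) refl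

-- Switchings, lifting of edge pairs, and two disjoint odd cycles

module Multigraph {k m : ℕ} where

  nonloop : (s t : Fin m → Fin k) → Fin m → Bool
  nonloop s t x = not (s x == t x)

  -- A loop at `v` cancels itself, so this is the set of non-loops at `v`, and summing it over an
  -- edge set gives the degree modulo 2.
  star : (s t : Fin m → Fin k) → Fin k → Fin m → Bool
  star s t v x = s x == v xor t x == v

  Cycle : (s t : Fin m → Fin k) → (Fin m → Bool) → Set
  Cycle s t A = ∀ v → ⨁ (λ x → A x ∧ star s t v x) ≡ false

  OddOn : (n A : Fin m → Bool) → Set
  OddOn n A = ⨁ (λ x → A x ∧ n x) ≡ true

  TwoDisjointOddCycles : (s t : Fin m → Fin k) → (Fin m → Bool) → Set
  TwoDisjointOddCycles s t n = Σ (Fin m → Bool) λ A → Σ (Fin m → Bool) λ B →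
    Cycle s t A × Cycle s t B × OddOn n A × OddOn n B × (∀ x → A x ∧ B x ≡ false)

  -- The signature after switching at the vertices of `p`: the sign changes on the edges of the cut
  -- defined by `p`.
  switched : (s t : Fin m → Fin k) → (Fin m → Bool) → (Fin k → Bool) → Fin m → Bool
  switched s t n p x = n x xor (p (s x) xor p (t x))

  -- All that the induction below keeps of a nowhere-zero flow.
  NoSingle : (s t : Fin m → Fin k) → (Fin m → Bool) → Set
  NoSingle s t n = ∀ p a → ¬ (∀ x → switched s t n p x ≡ a == x)

  other : (s t : Fin m → Fin k) → Fin k → Fin m → Fin k
  other s t v x = if s x == v then t x else s x

  other-end : ∀ s t v x → star s t v x ≡ true → (p : Fin k → Bool) →
              p (s x) xor p (t x) ≡ p v xor p (other s t v x)
  other-end s t v x h p with s x ≟ v | t x ≟ v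
  ... | yes refl | no _     = refl
  ... | no _     | yes refl = Bool.xor-comm (p (s x)) _

  -- Double counting: `p v` is counted once for each star edge at `v`, hence an even number of
  -- times. So switching preserves the parity of the number of negative edges.
  ⨁-coboundary : ∀ s t → (∀ v → ⨁ (star s t v) ≡ false) →
                 ∀ p → ⨁ (λ x → p (s x) xor p (t x)) ≡ false
  ⨁-coboundary s t even p = begin
      ⨁ (λ x → p (s x) xor p (t x))
    ≡⟨ ⨁-cong (λ x → sym (expand x)) ⟩
      ⨁ (λ x → ⨁ (λ v → p v ∧ star s t v x))
    ≡⟨ ⨁-comm (λ x v → p v ∧ star s t v x) ⟩
      ⨁ (λ v → ⨁ (λ x → p v ∧ star s t v x))
    ≡⟨ ⨁-zero _ (λ v → trans (sym (⨁-∧ (p v) (star s t v)))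
                             (trans (cong (p v ∧_) (even v)) (Bool.∧-zeroʳ (p v)))) ⟩
      false ∎
    where
    open ≡-Reasoning
    expand : ∀ x → ⨁ (λ v → p v ∧ star s t v x) ≡ p (s x) xor p (t x)
    expand x = trans (⨁-cong (λ v → Bool.∧-distribˡ-xor (p v) _ _))
              (trans (⨁-xor (λ v → p v ∧ s x == v) (λ v → p v ∧ t x == v))
                     (cong₂ _xor_ (⨁-evaluate p (s x)) (⨁-evaluate p (t x))))

  ⨁-switched : ∀ s t n → (∀ v → ⨁ (star s t v) ≡ false) → ⨁ n ≡ true →
               ∀ p → ⨁ (switched s t n p) ≡ true
  ⨁-switched s t n even odd p =
    trans (⨁-xor n _) (cong₂ _xor_ odd (⨁-coboundary s t even p))

  switched-xor₃ : ∀ s t n p q r x →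
    switched s t n (λ v → p v xor (q v xor r v)) x ≡
    switched s t n p x xor (switched s t n q x xor switched s t n r x)
  switched-xor₃ s t n p q r x =
    taut 7 (λ n p p′ q q′ r r′ → n xor ((p xor (q xor r)) xor (p′ xor (q′ xor r′))))
           (λ n p p′ q q′ r r′ →
              (n xor (p xor p′)) xor ((n xor (q xor q′)) xor (n xor (r xor r′)))) refl
      (n x) (p (s x)) (p (t x)) (q (s x)) (q (t x)) (r (s x)) (r (t x))

  -- The witness that lifting `e` and `f` fails. Since a switching and its complement give the same
  -- signature, `p v` can be normalised to `false`, which makes several triples at `v` comparable.
  Triple : (s t : Fin m → Fin k) → (Fin m → Bool) → Fin k → Fin m → Fin m → Set
  Triple s t n v e f = Σ (Fin k → Bool) λ p → Σ (Fin m) λ a →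
    p v ≡ false × (∀ x → switched s t n p x ≡ a == x xor (e == x xor f == x))

  -- On the left `f` is present exactly if `A` contains `e`, so it contributes `c`; on the right
  -- this contribution has moved to `e`. The two sides differ by `c` at both `e` and `f`, which sums
  -- to zero.
  ⨁-fold : ∀ {e f : Fin m} → e ≢ f → (A g g′ : Fin m → Bool) →
            g′ e ≡ g e xor g f → g′ f ≡ false → (∀ x → e ≢ x → f ≢ x → g′ x ≡ g x) →
            ⨁ (λ x → A (if f == x then e else x) ∧ g x) ≡ ⨁ (λ x → A x ∧ g′ x)
  ⨁-fold {e} {f} e≢f A g g′ ge gf gx = begin
      ⨁ (λ x → A (if f == x then e else x) ∧ g x)
    ≡⟨ ⨁-cong pointwise ⟩
      ⨁ (λ x → A x ∧ g′ x xor (c ∧ e == x xor c ∧ f == x))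
    ≡⟨ ⨁-xor (λ x → A x ∧ g′ x) _ ⟩
      ⨁ (λ x → A x ∧ g′ x) xor ⨁ (λ x → c ∧ e == x xor c ∧ f == x)
    ≡⟨ cong (⨁ (λ x → A x ∧ g′ x) xor_) cancel ⟩
      ⨁ (λ x → A x ∧ g′ x) xor false
    ≡⟨ Bool.xor-identityʳ _ ⟩
      ⨁ (λ x → A x ∧ g′ x) ∎
    where
    open ≡-Reasoning
    c = A e ∧ g f
    cancel : ⨁ (λ x → c ∧ e == x xor c ∧ f == x) ≡ false
    cancel = trans (⨁-xor (λ x → c ∧ e == x) (λ x → c ∧ f == x))
            (trans (cong₂ _xor_ (⨁-indicator c e) (⨁-indicator c f)) (Bool.xor-same c))
    pointwise : ∀ x → A (if f == x then e else x) ∧ g x ≡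
                      A x ∧ g′ x xor (c ∧ e == x xor c ∧ f == x)
    pointwise x with f ≟ x | e ≟ x
    ... | yes refl | yes refl = contradiction refl e≢f
    ... | yes refl | no _ rewrite gf =
      taut 3 (λ a b d → a ∧ b) (λ a b d → (d ∧ false) xor
                ((a ∧ b) ∧ false xor (a ∧ b) ∧ true)) refl
              (A e) (g f) (A f)
    ... | no _ | yes refl rewrite ge =
      taut 3 (λ a b d → a ∧ b) (λ a b d → a ∧ (b xor d) xor
                ((a ∧ d) ∧ true xor (a ∧ d) ∧ false)) refl
              (A e) (g e) (g f)
    ... | no f≢x | no e≢x rewrite gx x e≢x f≢x =
      taut 2 (λ a d → a) (λ a d → a xor (d ∧ false xor d ∧ false)) refl
              (A x ∧ g x) c

  -- The lift replaces the path o(e) – v – o(f) formed by e and f by the single edge e from o(e)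
  -- to o(f); the edge f is kept as a harmless positive loop.
  module Lift (s t : Fin m → Fin k) (n : Fin m → Bool) (v : Fin k) {e f : Fin m}
              (e≢f : e ≢ f) (ve : star s t v e ≡ true) (vf : star s t v f ≡ true) where

    s′ t′ : Fin m → Fin k
    s′ x = if f == x then v else if e == x then other s t v e else s x
    t′ x = if f == x then v else if e == x then other s t v f else t x

    n′ : Fin m → Bool
    n′ x = if f == x then false else if e == x then n e xor n f else n x

    n′-e : n′ e ≡ n e xor n f
    n′-e rewrite ==-≢ (e≢f ∘ sym) | ==-refl e = refl

    n′-f : n′ f ≡ false
    n′-f rewrite ==-refl f = refl

    n′-other : ∀ x → e ≢ x → f ≢ x → n′ x ≡ n x
    n′-other x e≢x f≢x rewrite ==-≢ e≢x | ==-≢ f≢x = refl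

    -- The value at the middle vertex `v` cancels. Taking `p` arbitrary covers degrees, with `p` the
    -- indicator `_== u`, as well as switchings.
    coboundary-e : ∀ (p : Fin k → Bool) →
      p (s′ e) xor p (t′ e) ≡ (p (s e) xor p (t e)) xor (p (s f) xor p (t f))
    coboundary-e p
      rewrite ==-≢ (e≢f ∘ sym) | ==-refl e | other-end s t v e ve p | other-end s t v f vf p =
      taut 3 (λ w x y → x xor y) (λ w x y → (w xor x) xor (w xor y)) refl (p v) _ _

    coboundary-f : ∀ (p : Fin k → Bool) → p (s′ f) xor p (t′ f) ≡ false
    coboundary-f p rewrite ==-refl f = Bool.xor-same (p v)

    coboundary-other : ∀ (p : Fin k → Bool) x → e ≢ x → f ≢ x →
      p (s′ x) xor p (t′ x) ≡ p (s x) xor p (t x)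
    coboundary-other p x e≢x f≢x rewrite ==-≢ e≢x | ==-≢ f≢x = refl

    -- Replaces the lifted edge by its path: `f` enters together with `e`, and whether `A` contains
    -- the loop `f` is forgotten.
    unlift : (Fin m → Bool) → Fin m → Bool
    unlift A x = A (if f == x then e else x)

    unlift-∂ : ∀ A u → ⨁ (λ x → unlift A x ∧ star s t u x) ≡ ⨁ (λ x → A x ∧ star s′ t′ u x)
    unlift-∂ A u = ⨁-fold e≢f A (star s t u) (star s′ t′ u)
      (coboundary-e (_== u)) (coboundary-f (_== u)) (coboundary-other (_== u))

    unlift-n : ∀ A → ⨁ (λ x → unlift A x ∧ n x) ≡ ⨁ (λ x → A x ∧ n′ x)
    unlift-n A = ⨁-fold e≢f A n n′ n′-e n′-f n′-other

    lift-even : (∀ u → ⨁ (star s t u) ≡ false) → ∀ u → ⨁ (star s′ t′ u) ≡ false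
    lift-even even u = trans (sym (unlift-∂ (λ _ → true) u)) (even u)

    lift-odd : ⨁ n ≡ true → ⨁ n′ ≡ true
    lift-odd odd = trans (sym (unlift-n (λ _ → true))) odd

    unlift-cycles : TwoDisjointOddCycles s′ t′ n′ → TwoDisjointOddCycles s t n
    unlift-cycles (A , B , ∂A , ∂B , oddA , oddB , disjoint) =
      unlift A , unlift B ,
      (λ u → trans (unlift-∂ A u) (∂A u)) , (λ u → trans (unlift-∂ B u) (∂B u)) ,
      trans (unlift-n A) oddA , trans (unlift-n B) oddB , (λ x → disjoint (if f == x then e else x))

    -- `f` turns from a non-loop into a loop, and `e`, the only other edge with new ends, was a
    -- non-loop already.
    fewer-nonloops : count (nonloop s′ t′) < count (nonloop s t)
    fewer-nonloops = count-strict mono f nonloop-f (star⇒nonloop f vf)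
      where
      star⇒nonloop : ∀ x → star s t v x ≡ true → nonloop s t x ≡ true
      star⇒nonloop x vx with s x ≟ t x
      ... | no _     = refl
      ... | yes sx≡tx = contradiction
        (trans (cong (λ u → u == v xor t x == v) sx≡tx) (Bool.xor-same (t x == v)))
        (true≢false vx)
      nonloop-f : nonloop s′ t′ f ≡ false
      nonloop-f rewrite ==-refl f | ==-refl v = refl
      mono : ∀ x → nonloop s′ t′ x ≡ true → nonloop s t x ≡ true
      mono x h with f ≟ x | e ≟ x
      ... | yes _ | _        = contradiction h (λ h → true≢false (==-refl v) (not-true h))
        where
        not-true : ∀ {b} → not b ≡ true → b ≡ false
        not-true {false} _ = refl
      ... | no _  | yes refl = star⇒nonloop x ve
      ... | no _  | no _     = h

    -- Outside `e` and `f` the switched signatures before and after the lift agree, and the lifted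
    -- sign of `e` is `σ e xor σ f`. Unless `e` and `f` are both negative and differ from `a`, the
    -- signature `σ` has a single negative edge, against `NoSingle`.
    singleton⇒Triple : NoSingle s t n → ∀ p a → p v ≡ false →
                       (∀ x → switched s′ t′ n′ p x ≡ a == x) → Triple s t n v e f
    singleton⇒Triple noSingle p a pv single = p , a , pv , negatives
      where
      σ = switched s t n p
      a≢f : a ≢ f
      a≢f refl = true≢false (trans (single f) (==-refl f))
                            (cong₂ _xor_ n′-f (coboundary-f p))
      σ-other : ∀ x → e ≢ x → f ≢ x → σ x ≡ a == x
      σ-other x e≢x f≢x = trans
        (sym (cong₂ _xor_ (n′-other x e≢x f≢x) (coboundary-other p x e≢x f≢x))) (single x)
      σ-ef : σ e xor σ f ≡ a == e
      σ-ef = trans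
        (xor-interchange (n e) (p (s e) xor p (t e)) (n f) (p (s f) xor p (t f)))
        (trans (sym (cong₂ _xor_ n′-e (coboundary-e p))) (single e))
      determined : ∀ b → (∀ x → e ≢ x → f ≢ x → a == x ≡ b == x) → σ e ≡ b == e → σ f ≡ b == f →
                   ⊥
      determined b ab be bf = noSingle p b pointwise
        where
        pointwise : ∀ x → σ x ≡ b == x
        pointwise x with e ≟ x | f ≟ x
        ... | yes refl | _        = be
        ... | no _     | yes refl = bf
        ... | no e≢x   | no f≢x   = trans (σ-other x e≢x f≢x) (ab x e≢x f≢x)
      classify : Dec (a ≡ e) → ∀ {y z} → σ e ≡ y → σ f ≡ z → y xor z ≡ a == e →
                 a ≢ e × σ e ≡ true × σ f ≡ true
      classify (no a≢e) {true} {true} σe σf _ = a≢e , σe , σf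
      classify (no a≢e) {false} {false} σe σf _ = ⊥-elim (determined a (λ _ _ _ → refl)
        (trans σe (sym (==-≢ a≢e))) (trans σf (sym (==-≢ a≢f))))
      classify (no a≢e) {true} {false} _ _ h = contradiction (==-true (sym h)) a≢e
      classify (no a≢e) {false} {true} _ _ h = contradiction (==-true (sym h)) a≢e
      classify (yes refl) {true} {true} _ _ h = contradiction (sym h) (true≢false (==-refl e))
      classify (yes refl) {false} {false} _ _ h = contradiction (sym h) (true≢false (==-refl e))
      classify (yes refl) {true} {false} σe σf _ = ⊥-elim (determined e (λ _ _ _ → refl)
        (trans σe (sym (==-refl e))) (trans σf (sym (==-≢ e≢f))))
      classify (yes refl) {false} {true} σe σf _ = ⊥-elim (determined f
        (λ x e≢x f≢x → trans (==-≢ e≢x) (sym (==-≢ f≢x)))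
        (trans σe (sym (==-≢ (e≢f ∘ sym)))) (trans σf (sym (==-refl f))))
      both-negative : a ≢ e × σ e ≡ true × σ f ≡ true
      both-negative = classify (a ≟ e) refl refl σ-ef
      negatives : ∀ x → σ x ≡ a == x xor (e == x xor f == x)
      negatives x with both-negative | e ≟ x | f ≟ x
      ... | _               | yes refl | yes refl = contradiction refl e≢f
      ... | a≢e , σe , _    | yes refl | no _     =
        trans σe (sym (cong (_xor true) (==-≢ a≢e)))
      ... | _   , _  , σf   | no _     | yes refl =
        trans σf (sym (cong (_xor true) (==-≢ a≢f)))
      ... | _               | no e≢x   | no f≢x   =
        trans (σ-other x e≢x f≢x) (sym (Bool.xor-identityʳ _))

    switched-complement : ∀ c p x → switched s′ t′ n′ (λ u → c xor p u) x ≡ switched s′ t′ n′ p x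
    switched-complement c p x =
      taut 4 (λ n c a b → n xor ((c xor a) xor (c xor b))) (λ n c a b → n xor (a xor b)) refl
        (n′ x) c _ _

    -- A search through all switchings decides whether the lift keeps `NoSingle`. If not, the
    -- switching found is complemented where necessary so that it vanishes at `v`.
    lift-or-Triple : NoSingle s t n →
      (NoSingle s′ t′ n′ → TwoDisjointOddCycles s′ t′ n′) →
      TwoDisjointOddCycles s t n ⊎ Triple s t n v e f
    lift-or-Triple noSingle rec
      with anyFunction? {P = λ p → Σ (Fin m) λ a → ∀ x → switched s′ t′ n′ p x ≡ a == x}
             (λ p≗q (a , h) → a , λ x →
               trans (cong (n′ x xor_) (cong₂ _xor_ (sym (p≗q (s′ x))) (sym (p≗q (t′ x))))) (h x))
             (λ p → any? λ a → all? λ x → switched s′ t′ n′ p x Bool.≟ a == x)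
    ... | no none = inj₁ (unlift-cycles (rec (λ p a h → none (p , a , h))))
    ... | yes (p , a , h) = inj₂ (singleton⇒Triple noSingle (λ u → p v xor p u) a
            (Bool.xor-same (p v)) (λ x → trans (switched-complement (p v) p x) (h x)))

  Signature : (s t : Fin m → Fin k) → (Fin m → Bool) → (Fin m → Bool) → Set
  Signature s t n φ = Σ (Fin k → Bool) λ p → ∀ x → switched s t n p x ≡ φ x

  -- The equivalent signatures form a coset of the cut space, and a coset is closed under sums of
  -- three elements.
  Signature-xor₃ : ∀ s t n {φ χ ψ} →
    Signature s t n φ → Signature s t n χ → Signature s t n ψ →
    Signature s t n (λ x → φ x xor (χ x xor ψ x))
  Signature-xor₃ s t n (p , hp) (q , hq) (r , hr) = (λ v → p v xor (q v xor r v)) , λ x →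
    trans (switched-xor₃ s t n p q r x) (cong₂ _xor_ (hp x) (cong₂ _xor_ (hq x) (hr x)))

  xor₃≢singleton : ∀ s t n → NoSingle s t n → ∀ {φ χ ψ} →
    Signature s t n φ → Signature s t n χ → Signature s t n ψ →
    ∀ a → ¬ (∀ x → φ x xor (χ x xor ψ x) ≡ a == x)
  xor₃≢singleton s t n noSingle Sφ Sχ Sψ a eq with Signature-xor₃ s t n Sφ Sχ Sψ
  ... | p , h = noSingle p a (λ x → trans (h x) (eq x))

  -- With p, q, r the switchings of the three triples, maj p q r has negative edges e, f, g and
  -- possibly an even number of the a, b, c; if this number is 2, then adding two of p, q, r gives
  -- a switching with a single negative edge.
  three-star-edges : ∀ s t n → (∀ v → ⨁ (star s t v) ≡ false) → ⨁ n ≡ true → NoSingle s t n →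
    ∀ v {e f g} → e ≢ f → e ≢ g → f ≢ g →
    star s t v e ≡ true → star s t v f ≡ true → star s t v g ≡ true →
    Triple s t n v e f → Triple s t n v e g → Triple s t n v f g →
    Signature s t n (λ x → e == x xor (f == x xor g == x))
  three-star-edges s t n even odd noSingle v {e} {f} {g} e≢f e≢g f≢g ve vf vg
    (p , a , pv , hp) (q , b , qv , hq) (r , c , rv , hr) = result
    where
    M : Fin k → Bool
    M u = maj (p u) (q u) (r u)
    efg φ : Fin m → Bool
    efg x = e == x xor (f == x xor g == x)
    φ = switched s t n M
    Sp : Signature s t n _
    Sp = p , hp
    Sq : Signature s t n _
    Sq = q , hq
    Sr : Signature s t n _
    Sr = r , hr
    impossible : ∀ {φ χ ψ} → Signature s t n φ → Signature s t n χ → Signature s t n ψ →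
                 ∀ a → ¬ (∀ x → φ x xor (χ x xor ψ x) ≡ a == x)
    impossible = xor₃≢singleton s t n noSingle
    -- Each of `e`, `f`, `g` lies in two of the triples, so the three signatures sum to the
    -- indicators of `a`, `b`, `c`. If two of these coincide, the third remains as a single negative
    -- edge.
    a≢b : a ≢ b
    a≢b refl = impossible Sp Sq Sr c (λ x →
      taut 5 (λ a c e f g → (a xor (e xor f)) xor ((a xor (e xor g)) xor (c xor (f xor g))))
             (λ a c e f g → c) refl
        (a == x) (c == x) (e == x) (f == x) (g == x))
    a≢c : a ≢ c
    a≢c refl = impossible Sp Sq Sr b (λ x →
      taut 5 (λ a c e f g → (a xor (e xor f)) xor ((c xor (e xor g)) xor (a xor (f xor g))))
             (λ a c e f g → c) refl
        (a == x) (b == x) (e == x) (f == x) (g == x))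
    b≢c : b ≢ c
    b≢c refl = impossible Sp Sq Sr a (λ x →
      taut 5 (λ a c e f g → (a xor (e xor f)) xor ((c xor (e xor g)) xor (c xor (f xor g))))
             (λ a c e f g → a) refl
        (a == x) (b == x) (e == x) (f == x) (g == x))
    α β γ : Bool
    α = φ a xor efg a
    β = φ b xor efg b
    γ = φ c xor efg c

    -- All three switchings vanish at `v`, so only the other end of `x` votes, and self-duality
    -- applies.
    at-v : ∀ x → star s t v x ≡ true →
           φ x ≡ maj (switched s t n p x) (switched s t n q x) (switched s t n r x)
    at-v x vx
      rewrite other-end s t v x vx M | other-end s t v x vx p | other-end s t v x vx q
            | other-end s t v x vx r | pv | qv | rv = sym (maj-dual (n x) _ _ _)

    -- For an edge positive in all three signatures, the votes at `t x` are those at `s x` shifted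
    -- by `n x`, hence so is their majority.
    away : ∀ x → switched s t n p x ≡ false → switched s t n q x ≡ false →
           switched s t n r x ≡ false → φ x ≡ false
    away x px qx rx = begin
        n x xor (M (s x) xor M (t x))
      ≡⟨ cong (λ y → n x xor (M (s x) xor y)) (maj-cong (end p px) (end q qx) (end r rx)) ⟩
        n x xor (M (s x) xor maj (n x xor p (s x)) (n x xor q (s x)) (n x xor r (s x)))
      ≡⟨ cong (λ y → n x xor (M (s x) xor y)) (maj-dual (n x) _ _ _) ⟩
        n x xor (M (s x) xor (n x xor M (s x)))
      ≡⟨ taut 2 (λ n y → n xor (y xor (n xor y))) (λ n y → false) refl (n x) (M (s x)) ⟩
        false ∎
      where
      open ≡-Reasoning
      end : ∀ u → switched s t n u x ≡ false → u (t x) ≡ n x xor u (s x)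
      end u h = trans
        (taut 3 (λ n y z → z) (λ n y z → (n xor y) xor (n xor (y xor z))) refl
          (n x) (u (s x)) (u (t x)))
        (trans (cong ((n x xor u (s x)) xor_) h) (Bool.xor-identityʳ _))

    generic : ∀ x → a ≢ x → b ≢ x → c ≢ x → φ x ≡ efg x
    generic x a≢x b≢x c≢x with hp x | hq x | hr x
    ... | px | qx | rx rewrite ==-≢ a≢x | ==-≢ b≢x | ==-≢ c≢x with e ≟ x | f ≟ x | g ≟ x
    ... | yes refl | yes refl | _        = contradiction refl e≢f
    ... | yes refl | _        | yes refl = contradiction refl e≢g
    ... | no _     | yes refl | yes refl = contradiction refl f≢g
    ... | yes refl | no _     | no _     = trans (at-v x ve) (maj-cong px qx rx)
    ... | no _     | yes refl | no _     = trans (at-v x vf) (maj-cong px qx rx)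
    ... | no _     | no _     | yes refl = trans (at-v x vg) (maj-cong px qx rx)
    ... | no _     | no _     | no _     = away x px qx rx

    negatives : ∀ x → φ x ≡ efg x xor (α ∧ a == x xor (β ∧ b == x xor γ ∧ c == x))
    negatives x with a ≟ x | b ≟ x | c ≟ x
    ... | yes refl | yes refl | _        = contradiction refl a≢b
    ... | yes refl | no _     | yes refl = contradiction refl a≢c
    ... | no _     | yes refl | yes refl = contradiction refl b≢c
    ... | yes refl | no _     | no _     =
      taut 4 (λ y z β γ → y) (λ y z β γ → z xor ((y xor z) ∧ true xor (β ∧ false xor γ ∧ false)))
        refl (φ x) (efg x) β γ
    ... | no _     | yes refl | no _     =
      taut 4 (λ y z α γ → y) (λ y z α γ → z xor (α ∧ false xor ((y xor z) ∧ true xor γ ∧ false)))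
        refl (φ x) (efg x) α γ
    ... | no _     | no _     | yes refl =
      taut 4 (λ y z α β → y) (λ y z α β → z xor (α ∧ false xor (β ∧ false xor (y xor z) ∧ true)))
        refl (φ x) (efg x) α β
    ... | no a≢x   | no b≢x   | no c≢x   = trans (generic x a≢x b≢x c≢x)
      (taut 4 (λ z α β γ → z) (λ z α β γ → z xor (α ∧ false xor (β ∧ false xor γ ∧ false)))
        refl (efg x) α β γ)

    -- The number of negative edges stays odd under switching, so an even number of the deviations
    -- `α`, `β`, `γ` are `true`.
    parity : true ≡ true xor (α xor (β xor γ))
    parity = begin
        true
      ≡⟨ sym (⨁-switched s t n even odd M) ⟩
        ⨁ φ
      ≡⟨ ⨁-cong negatives ⟩
        ⨁ (λ x → efg x xor (α ∧ a == x xor (β ∧ b == x xor γ ∧ c == x)))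
      ≡⟨ trans (⨁-xor efg _) (cong₂ _xor_ ⨁-efg
           (trans (⨁-xor (λ x → α ∧ a == x) _) (cong₂ _xor_ (⨁-indicator α a)
             (trans (⨁-xor (λ x → β ∧ b == x) _)
                    (cong₂ _xor_ (⨁-indicator β b) (⨁-indicator γ c)))))) ⟩
        true xor (α xor (β xor γ)) ∎
      where
      open ≡-Reasoning
      ⨁-efg : ⨁ efg ≡ true
      ⨁-efg = trans (⨁-xor (e ==_) _) (cong₂ _xor_ (⨁-point e)
                (trans (⨁-xor (f ==_) (g ==_)) (cong₂ _xor_ (⨁-point f) (⨁-point g))))

    result : Signature s t n efg
    result with α | β | γ | parity | negatives
    ... | false | false | false | _ | φ≗ =
      M , λ x → trans (φ≗ x) (Bool.xor-identityʳ _)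
    ... | true | true | false | _ | φ≗ = ⊥-elim (impossible Sp Sq (M , φ≗) e (λ x →
        taut 6 (λ a b c e f g → (a xor (e xor f)) xor ((b xor (e xor g)) xor
          ((e xor (f xor g)) xor (a xor (b xor false))))) (λ a b c e f g → e) refl
          (a == x) (b == x) (c == x) (e == x) (f == x) (g == x)))
    ... | true | false | true | _ | φ≗ = ⊥-elim (impossible Sp Sr (M , φ≗) f (λ x →
        taut 6 (λ a b c e f g → (a xor (e xor f)) xor ((c xor (f xor g)) xor
          ((e xor (f xor g)) xor (a xor c)))) (λ a b c e f g → f) refl
          (a == x) (b == x) (c == x) (e == x) (f == x) (g == x)))
    ... | false | true | true | _ | φ≗ = ⊥-elim (impossible Sq Sr (M , φ≗) g (λ x →
        taut 6 (λ a b c e f g → (b xor (e xor g)) xor ((c xor (f xor g)) xor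
          ((e xor (f xor g)) xor (b xor c)))) (λ a b c e f g → g) refl
          (a == x) (b == x) (c == x) (e == x) (f == x) (g == x)))

  -- Each loop is a cycle by itself. Oddness provides one negative loop, and `NoSingle` for the
  -- trivial switching a second one.
  loops-only : ∀ s t n → (∀ x → s x ≡ t x) → ⨁ n ≡ true → NoSingle s t n →
               TwoDisjointOddCycles s t n
  loops-only s t n loop odd noSingle
    with ⨁-differ n (λ _ → false)
           (λ h → true≢false odd (trans h (⨁-zero {m} (λ _ → false) (λ _ → refl))))
  ... | e , ne with ¬∀⟶∃¬ m _ (λ x → n x Bool.≟ e == x)
                      (λ h → noSingle (λ _ → false) e (λ x → trans (Bool.xor-identityʳ (n x)) (h x)))
  ... | f , nf = (e ==_) , (f ==_) , cycle e , cycle f , odd-singleton e (≢false⇒true ne) ,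
      odd-singleton f (≢false⇒true (λ nf≡false → nf (trans nf≡false (sym (==-≢ e≢f))))) ,
      disjoint e≢f
    where
    e≢f : e ≢ f
    e≢f refl = nf (trans (≢false⇒true ne) (sym (==-refl e)))
    cycle : ∀ e → Cycle s t (e ==_)
    cycle e v = ⨁-zero _ (λ x → trans
      (cong (e == x ∧_) (trans (cong (λ u → u == v xor t x == v) (loop x))
                              (Bool.xor-same (t x == v))))
      (Bool.∧-zeroʳ _))
    odd-singleton : ∀ e → n e ≡ true → OddOn n (e ==_)
    odd-singleton e ne = trans (⨁-cong (λ x → Bool.∧-comm (e == x) (n x)))
                               (trans (⨁-evaluate n e) ne)
    disjoint : ∀ {e f : Fin m} → e ≢ f → ∀ x → e == x ∧ f == x ≡ false
    disjoint {e} {f} e≢f x with e ≟ x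
    ... | no _     = refl
    ... | yes refl = ==-≢ (e≢f ∘ sym)

  -- Pairs of star edges at an end `v` of some non-loop are lifted. If every lift tried fails, the
  -- resulting triples contradict `NoSingle`, in one way for two star edges at `v` and in another
  -- for four or more.
  disjoint-odd-cycles : ∀ bound s t n → count (nonloop s t) < bound →
    (∀ v → ⨁ (star s t v) ≡ false) → ⨁ n ≡ true → NoSingle s t n → TwoDisjointOddCycles s t n
  disjoint-odd-cycles (suc bound) s t n (s≤s size) even odd noSingle
    with any? (λ x → ¬? (s x ≟ t x))
  ... | no none = loops-only s t n loop odd noSingle
    where
    loop : ∀ x → s x ≡ t x
    loop x with s x ≟ t x
    ... | yes eq = eq
    ... | no neq = contradiction (x , neq) none
  ... | yes (e , se≢te) = at-vertex
    where
    v : Fin k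
    v = s e
    ve : star s t v e ≡ true
    ve rewrite ==-refl (s e) | ==-≢ (se≢te ∘ sym) = refl

    lift-or-Triple : ∀ {e f} → e ≢ f → star s t v e ≡ true → star s t v f ≡ true →
                     TwoDisjointOddCycles s t n ⊎ Triple s t n v e f
    lift-or-Triple e≢f ve vf = L.lift-or-Triple noSingle
      (disjoint-odd-cycles bound L.s′ L.t′ L.n′ (ℕ.<-≤-trans L.fewer-nonloops size)
        (L.lift-even even) (L.lift-odd odd))
      where module L = Lift s t n v e≢f ve vf

    -- The star of `v` has even size, so a subset of odd size misses one of its edges; this yields
    -- the second and the fourth edge.
    next : ∀ (φ : Fin m → Bool) → ⨁ φ ≡ true → (∀ x → φ x ≡ true → star s t v x ≡ true) →
           Σ (Fin m) λ x → star s t v x ≡ true × φ x ≡ false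
    next φ φ-odd φ⊆star with ⨁-differ (star s t v) φ
      (λ h → true≢false φ-odd (trans (sym h) (even v)))
    ... | x , h with φ x in φx
    ... | true  = contradiction (φ⊆star x φx) h
    ... | false = x , ≢false⇒true h , φx

    Result : Set
    Result = TwoDisjointOddCycles s t n

    -- Switching at `v` in addition changes exactly `e` and `f`, which leaves `a` as the single
    -- negative edge.
    two-edges : ∀ {e f} → (∀ x → star s t v x ≡ e == x xor f == x) → Triple s t n v e f → Result
    two-edges {e} {f} star-v (p , a , _ , hp) = ⊥-elim (noSingle (λ u → p u xor u == v) a (λ x →
      trans (taut 5 (λ n p p′ q q′ → n xor ((p xor q) xor (p′ xor q′)))
                    (λ n p p′ q q′ → (n xor (p xor p′)) xor (q xor q′)) refl
                    (n x) (p (s x)) (p (t x)) (s x == v) (t x == v))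
     (trans (cong₂ _xor_ (hp x) (star-v x))
            (taut 3 (λ a e f → (a xor (e xor f)) xor (e xor f)) (λ a e f → a) refl
                    (a == x) (e == x) (f == x)))))

    four-edges : ∀ {e f g h} → e ≢ f → e ≢ g → e ≢ h → f ≢ g → f ≢ h → g ≢ h →
      star s t v e ≡ true → star s t v f ≡ true → star s t v g ≡ true → star s t v h ≡ true →
      Result
    four-edges {e} {f} {g} {h} e≢f e≢g e≢h f≢g f≢h g≢h ve vf vg vh
      with lift-or-Triple e≢f ve vf | lift-or-Triple e≢g ve vg | lift-or-Triple e≢h ve vh
         | lift-or-Triple f≢g vf vg | lift-or-Triple f≢h vf vh | lift-or-Triple g≢h vg vh
    ... | inj₁ r | _ | _ | _ | _ | _ = r
    ... | _ | inj₁ r | _ | _ | _ | _ = r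
    ... | _ | _ | inj₁ r | _ | _ | _ = r
    ... | _ | _ | _ | inj₁ r | _ | _ = r
    ... | _ | _ | _ | _ | inj₁ r | _ = r
    ... | _ | _ | _ | _ | _ | inj₁ r = r
    ... | inj₂ ef | inj₂ eg | inj₂ eh | inj₂ fg | inj₂ fh | inj₂ (p , a , _ , hp) =
      -- The signatures with negative edges `e`, `f`, `g` and `e`, `f`, `h` sum to `g`, `h`; adding
      -- the triple `a`, `g`, `h` leaves `a` alone.
      ⊥-elim (xor₃≢singleton s t n noSingle (p , hp)
        (three-star-edges s t n even odd noSingle v e≢f e≢g f≢g ve vf vg ef eg fg)
        (three-star-edges s t n even odd noSingle v e≢f e≢h f≢h ve vf vh ef eh fh) a
        (λ x → taut 5 (λ a e f g h → (a xor (g xor h)) xor ((e xor (f xor g)) xor (e xor (f xor h))))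
                      (λ a e f g h → a) refl (a == x) (e == x) (f == x) (g == x) (h == x)))

    ≢-of : ∀ (e f : Fin m) → e == f ≡ false → e ≢ f
    ≢-of e f e≢f refl = true≢false (==-refl e) e≢f

    at-vertex : Result
    at-vertex with next (e ==_) (⨁-point e) (λ x h → subst (λ y → star s t v y ≡ true) (==-true h) ve)
    ... | f , vf , ef with all? (λ x → star s t v x Bool.≟ e == x xor f == x)
    ... | yes star-v with lift-or-Triple (≢-of e f ef) ve vf
    ...   | inj₁ r  = r
    ...   | inj₂ t₁ = two-edges {e} {f} star-v t₁
    at-vertex | f , vf , ef | no more
      with ¬∀⟶∃¬ m _ (λ x → star s t v x Bool.≟ e == x xor f == x) more
    ... | g , vg≢ with e ≟ g | f ≟ g
    ... | yes refl | yes f≡e  = contradiction (sym f≡e) (≢-of e f ef)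
    ... | yes refl | no _     = contradiction ve vg≢
    ... | no _     | yes refl = contradiction vf vg≢
    ... | no e≢g   | no f≢g with next (λ x → e == x xor (f == x xor g == x))
          (trans (⨁-xor (e ==_) _) (cong₂ _xor_ (⨁-point e)
            (trans (⨁-xor (f ==_) (g ==_)) (cong₂ _xor_ (⨁-point f) (⨁-point g))))) inside
      where
      inside : ∀ x → e == x xor (f == x xor g == x) ≡ true → star s t v x ≡ true
      inside x h with e ≟ x | f ≟ x | g ≟ x
      ... | yes refl | _ | _ = ve
      ... | no _ | yes refl | _ = vf
      ... | no _ | no _ | yes refl = ≢false⇒true vg≢
    ... | h , vh , efgh with e ≟ h | f ≟ h | g ≟ h
    ... | no e≢h | no f≢h | no g≢h =
      four-edges (≢-of e f ef) e≢g e≢h f≢g f≢h g≢h ve vf (≢false⇒true vg≢) vh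
    ... | yes refl | yes e≡f  | _        = contradiction (sym e≡f) (≢-of e f ef)
    ... | yes refl | no _     | yes refl = contradiction refl e≢g
    ... | no _     | yes refl | yes refl = contradiction refl f≢g

-- Parity of natural numbers and signs of integers

open SemiringSum (CommutativeRing.semiring ℤ.+-*-commutativeRing)
  using () renaming
  ( sum to ∑; sum-cong-≗ to ∑-cong; ∑-distrib-+ to ∑-+; ∑-comm to ∑-comm
  ; *-distribˡ-sum to ∑-* )

open SumSingle ℤ.+-0-commutativeMonoid
  using () renaming (sum-zero to ∑-zero; sum-single to ∑-single)

parity : ℕ → Bool
parity zero    = false
parity (suc n) = not (parity n)

parity-+ : ∀ m n → parity (m ℕ.+ n) ≡ parity m xor parity n
parity-+ zero    n = refl
parity-+ (suc m) n = trans (cong not (parity-+ m n)) (Bool.not-distribˡ-xor (parity m) (parity n))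

parity-sum : ∀ {m} (f : Fin m → ℕ) → parity (sumℕ f) ≡ ⨁ (parity ∘ f)
parity-sum {zero}  f = refl
parity-sum {suc m} f = trans (parity-+ (f zero) _)
  (cong (parity (f zero) xor_) (parity-sum (f ∘ suc)))

parity-if : ∀ b n → parity (if b then n else 0) ≡ b ∧ parity n
parity-if true  n = refl
parity-if false n = refl

Even⇒parity : ∀ {n} → Even n → parity n ≡ false
Even⇒parity (divides q refl) = double q
  where
  double : ∀ q → parity (q ℕ.* 2) ≡ false
  double zero    = refl
  double (suc q) = trans (Bool.not-involutive _) (double q)

parity⇒Even : ∀ n → parity n ≡ false → Even n
parity⇒Even zero          _ = divides 0 refl
parity⇒Even (suc (suc n)) h with parity⇒Even n (trans (sym (Bool.not-involutive _)) h)
... | divides q eq = divides (suc q) (cong (λ n → suc (suc n)) eq)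

Odd⇒parity : ∀ n → Odd n → parity n ≡ true
Odd⇒parity n odd = ≢false⇒true (odd ∘ parity⇒Even n)

parity⇒Odd : ∀ {n} → parity n ≡ true → Odd n
parity⇒Odd h = true≢false h ∘ Even⇒parity

sumℤ≡∑ : ∀ {m} (f : Fin m → ℤ) → sumℤ f ≡ ∑ f
sumℤ≡∑ {zero}  f = refl
sumℤ≡∑ {suc m} f = cong (λ y → f zero ℤ.+ y) (sumℤ≡∑ (f ∘ suc))

sign : Bool → ℤ
sign b = if b then -1ℤ else 1ℤ

-- The contribution of a half-edge to the net outflow at its end; `true` stands for outgoing.
oriented : Bool → ℤ → ℤ
oriented o x = if o then x else - x

-- Weighting a vertex with -1 amounts to reversing the half-edges at it.
sign-oriented : ∀ b o x → sign b ℤ.* oriented o x ≡ oriented (o xor b) x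
sign-oriented false true  x = ℤ.*-identityˡ x
sign-oriented false false x = ℤ.*-identityˡ (- x)
sign-oriented true  true  x = ℤ.-1*i≡-i x
sign-oriented true  false x = trans (ℤ.-1*i≡-i (- x)) (ℤ.neg-involutive x)

oriented-cancel : ∀ b x → oriented b x ℤ.+ oriented (not b) x ≡ 0ℤ
oriented-cancel true  x = ℤ.+-inverseʳ x
oriented-cancel false x = ℤ.+-inverseˡ x

-- The integers have no 2-torsion.
oriented-double : ∀ b x → oriented b x ℤ.+ oriented b x ≡ 0ℤ → x ≡ 0ℤ
oriented-double _     (+ 0)         _ = refl
oriented-double true  (+ (suc n)) ()
oriented-double false (+ (suc n)) ()
oriented-double true  -[1+ n ]    ()
oriented-double false -[1+ n ]    ()

-- Degrees and negative edges modulo 2, and the obstruction to a nowhere-zero flow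

module SignedGraphParity (G : SignedGraph) where
  open SignedGraph G public

  s t : Fin nE → Fin nV
  s e = end e zero
  t e = end e (suc zero)

  open Multigraph {nV} {nE} public

  ∂ : EdgeSet G → Fin nV → Bool
  ∂ S v = ⨁ (λ e → S e ∧ star s t v e)

  negParity : EdgeSet G → Bool
  negParity S = ⨁ (λ e → S e ∧ neg e)

  parity-deg : ∀ S v → parity (deg G S v) ≡ ∂ S v
  parity-deg S v = trans
    (parity-sum (λ e → if S e then sumℕ (λ i → if does (end e i ≟ v) then 1 else 0) else 0))
    (⨁-cong (λ e → trans (parity-if (S e) _) (cong (S e ∧_) (half (s e == v) (t e == v)))))
    where
    half : ∀ a b → parity ((if a then 1 else 0) ℕ.+ ((if b then 1 else 0) ℕ.+ 0)) ≡ a xor b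
    half false false = refl
    half false true  = refl
    half true  false = refl
    half true  true  = refl

  parity-negCount : ∀ S → parity (negCount G S) ≡ negParity S
  parity-negCount S = trans (parity-sum {nE} _) (⨁-cong (λ e → edge (S e) (neg e)))
    where
    edge : ∀ a b → parity (if (if a then b else false) then 1 else 0) ≡ a ∧ b
    edge false b     = refl
    edge true  true  = refl
    edge true  false = refl

  EvenDegrees : EdgeSet G → Set
  EvenDegrees S = ∀ v → ∂ S v ≡ false

  Even-deg⇒∂ : ∀ {S} → (∀ v → Even (deg G S v)) → EvenDegrees S
  Even-deg⇒∂ {S} even v = trans (sym (parity-deg S v)) (Even⇒parity (even v))

  ∂⇒Even-deg : ∀ {S} → EvenDegrees S → ∀ v → Even (deg G S v)
  ∂⇒Even-deg {S} even v = parity⇒Even _ (trans (parity-deg S v) (even v))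

  Odd⇒negParity : ∀ {S} → Odd (negCount G S) → negParity S ≡ true
  Odd⇒negParity {S} odd = trans (sym (parity-negCount S)) (Odd⇒parity _ odd)

  negParity⇒Odd : ∀ {S} → negParity S ≡ true → Odd (negCount G S)
  negParity⇒Odd {S} odd = parity⇒Odd (trans (parity-negCount S) odd)

  Even⇒negParity : ∀ {S} → Even (negCount G S) → negParity S ≡ false
  Even⇒negParity {S} even = trans (sym (parity-negCount S)) (Even⇒parity even)

  negParity⇒Even : ∀ {S} → negParity S ≡ false → Even (negCount G S)
  negParity⇒Even {S} even = parity⇒Even _ (trans (parity-negCount S) even)

  infixr 5 _△_
  -- Symmetric difference, for which `∂` and `negParity` are additive; it serves as difference of
  -- nested sets and as union of disjoint ones.
  _△_ : EdgeSet G → EdgeSet G → EdgeSet G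
  (S △ T) e = S e xor T e

  ∂-△ : ∀ S T v → ∂ (S △ T) v ≡ ∂ S v xor ∂ T v
  ∂-△ S T v = trans (⨁-cong (λ e → Bool.∧-distribʳ-xor (star s t v e) (S e) (T e)))
                    (⨁-xor (λ e → S e ∧ star s t v e) _)

  negParity-△ : ∀ S T → negParity (S △ T) ≡ negParity S xor negParity T
  negParity-△ S T = trans (⨁-cong (λ e → Bool.∧-distribʳ-xor (neg e) (S e) (T e)))
                          (⨁-xor (λ e → S e ∧ neg e) _)

  △-even : ∀ {S T} → EvenDegrees S → EvenDegrees T → EvenDegrees (S △ T)
  △-even {S} {T} evenS evenT v = trans (∂-△ S T v) (cong₂ _xor_ (evenS v) (evenT v))

  △-parity : ∀ {S T x y} → negParity S ≡ x → negParity T ≡ y → negParity (S △ T) ≡ x xor y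
  △-parity {S} {T} oddS oddT = trans (negParity-△ S T) (cong₂ _xor_ oddS oddT)

  ∂-cong : ∀ {S T : EdgeSet G} → S ≗ T → ∀ v → ∂ S v ≡ ∂ T v
  ∂-cong S≗T v = ⨁-cong (λ e → cong (_∧ star s t v e) (S≗T e))

  negParity-cong : ∀ {S T : EdgeSet G} → S ≗ T → negParity S ≡ negParity T
  negParity-cong S≗T = ⨁-cong (λ e → cong (_∧ neg e) (S≗T e))

  -- The net flows weighted by the signs of `p` sum to zero. Regrouped by edges, the half-edges of
  -- each edge cancel unless it is negative after switching, so a single negative edge `a` would
  -- force `ξ a` to be zero.
  NZFlow⇒NoSingle : HasNZFlow G → NoSingle s t neg
  NZFlow⇒NoSingle (τ , valid , ξ , flow , nonzero) p a single =
    nonzero a (oriented-double (τ a zero xor p (s a)) (ξ a)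
      (trans (sym (edge-negative a (trans (single a) (==-refl a))))
      (trans (sym (∑-single term a λ x a≢x → edge-positive x (trans (single x) (==-≢ a≢x)))) total)))
    where
    open ≡-Reasoning
    c : Fin nE → Fin 2 → ℤ
    c e i = oriented (τ e i) (ξ e)
    term : Fin nE → ℤ
    term e = ∑ (λ i → sign (p (end e i)) ℤ.* c e i)

    -- Validity of the orientation as an equation, so that `neg e` can be eliminated in favour of
    -- `τ`.
    opposite : ∀ e → neg e ≡ not (τ e zero xor τ e (suc zero))
    opposite e with neg e | τ e zero | τ e (suc zero) | valid e
    ... | true  | true  | .true  | refl = refl
    ... | true  | false | .false | refl = refl
    ... | false | true  | false  | _    = refl
    ... | false | false | true   | _    = refl
    ... | false | true  | true   | h    = contradiction refl h
    ... | false | false | false  | h    = contradiction refl h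

    term-oriented : ∀ e → term e ≡ oriented (τ e zero xor p (s e)) (ξ e) ℤ.+
                                   oriented (τ e (suc zero) xor p (t e)) (ξ e)
    term-oriented e = cong₂ ℤ._+_ (sign-oriented (p (s e)) (τ e zero) (ξ e))
      (trans (ℤ.+-identityʳ _) (sign-oriented (p (t e)) (τ e (suc zero)) (ξ e)))

    -- The two signs in term-oriented agree iff the edge is negative after switching.
    sign-t : ∀ e {b} → switched s t neg p e ≡ b →
             τ e (suc zero) xor p (t e) ≡ not b xor (τ e zero xor p (s e))
    sign-t e refl rewrite opposite e =
      taut 4 (λ o o′ y z → o′ xor z)
             (λ o o′ y z → not (not (o xor o′) xor (y xor z)) xor (o xor y)) refl
             (τ e zero) (τ e (suc zero)) (p (s e)) (p (t e))

    edge-positive : ∀ e → switched s t neg p e ≡ false → term e ≡ 0ℤ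
    edge-positive e h = trans (term-oriented e)
      (trans (cong (λ b → oriented (τ e zero xor p (s e)) (ξ e) ℤ.+ oriented b (ξ e)) (sign-t e h))
             (oriented-cancel (τ e zero xor p (s e)) (ξ e)))

    edge-negative : ∀ e → switched s t neg p e ≡ true →
      term e ≡ oriented (τ e zero xor p (s e)) (ξ e) ℤ.+ oriented (τ e zero xor p (s e)) (ξ e)
    edge-negative e h = trans (term-oriented e)
      (cong (λ b → oriented (τ e zero xor p (s e)) (ξ e) ℤ.+ oriented b (ξ e)) (sign-t e h))

    incidence : Fin nE → Fin 2 → Fin nV → ℤ
    incidence e i v = if does (end e i ≟ v) then c e i else 0ℤ

    net : ∀ v → netFlow G τ ξ v ≡ ∑ (λ e → ∑ (λ i → incidence e i v))
    net v = trans (sumℤ≡∑ (λ e → sumℤ (λ i → incidence e i v)))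
                  (∑-cong (λ e → sumℤ≡∑ (λ i → incidence e i v)))

    at-end : ∀ e i → ∑ (λ v → sign (p v) ℤ.* incidence e i v) ≡ sign (p (end e i)) ℤ.* c e i
    at-end e i = trans (∑-single (λ v → sign (p v) ℤ.* incidence e i v) (end e i) (λ v h →
        trans (cong (λ b → sign (p v) ℤ.* (if b then c e i else 0ℤ)) (==-≢ h))
              (ℤ.*-zeroʳ (sign (p v)))))
      (cong (λ b → sign (p (end e i)) ℤ.* (if b then c e i else 0ℤ)) (==-refl (end e i)))

    total : ∑ term ≡ 0ℤ
    total = begin
        ∑ (λ e → ∑ (λ i → sign (p (end e i)) ℤ.* c e i))
      ≡⟨ ∑-cong (λ e → ∑-cong (λ i → sym (at-end e i))) ⟩
        ∑ (λ e → ∑ (λ i → ∑ (λ v → sign (p v) ℤ.* incidence e i v)))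
      ≡⟨ ∑-cong (λ e → ∑-comm (λ i v → sign (p v) ℤ.* incidence e i v)) ⟩
        ∑ (λ e → ∑ (λ v → ∑ (λ i → sign (p v) ℤ.* incidence e i v)))
      ≡⟨ ∑-comm (λ e v → ∑ (λ i → sign (p v) ℤ.* incidence e i v)) ⟩
        ∑ (λ v → ∑ (λ e → ∑ (λ i → sign (p v) ℤ.* incidence e i v)))
      ≡⟨ ∑-cong (λ v → trans (∑-cong (λ e → sym (∑-* (sign (p v)) (λ i → incidence e i v))))
                             (sym (∑-* (sign (p v)) (λ e → ∑ (λ i → incidence e i v))))) ⟩
        ∑ (λ v → sign (p v) ℤ.* ∑ (λ e → ∑ (λ i → incidence e i v)))
      ≡⟨ ∑-zero _ (λ v → trans (cong (sign (p v) ℤ.*_) (trans (sym (net v)) (flow v)))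
                               (ℤ.*-zeroʳ (sign (p v)))) ⟩
        0ℤ ∎

-- Sums of natural numbers and Boolean auxiliaries

open SemiringSum ℕ.+-*-semiring
  using () renaming
  ( sum to ∑ⁿ; sum-cong-≗ to ∑ⁿ-cong; ∑-distrib-+ to ∑ⁿ-+ )

open SumSingle ℕ.+-0-commutativeMonoid
  using () renaming (sum-zero to ∑ⁿ-zero; sum-single to ∑ⁿ-single)

sumℕ≡∑ⁿ : ∀ {m} (f : Fin m → ℕ) → sumℕ f ≡ ∑ⁿ f
sumℕ≡∑ⁿ {zero}  f = refl
sumℕ≡∑ⁿ {suc m} f = cong (λ y → f zero ℕ.+ y) (sumℕ≡∑ⁿ (f ∘ suc))

sumℕ-cong : ∀ {m} {f g : Fin m → ℕ} → f ≗ g → sumℕ f ≡ sumℕ g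
sumℕ-cong {f = f} {g} f≗g = trans (sumℕ≡∑ⁿ f) (trans (∑ⁿ-cong f≗g) (sym (sumℕ≡∑ⁿ g)))

sumℕ-zero : ∀ {m} (f : Fin m → ℕ) → (∀ x → f x ≡ 0) → sumℕ f ≡ 0
sumℕ-zero f h = trans (sumℕ≡∑ⁿ f) (∑ⁿ-zero f h)

bool-ext : ∀ {x y} → (x ≡ true → y ≡ true) → (y ≡ true → x ≡ true) → x ≡ y
bool-ext {true}  f g = sym (f refl)
bool-ext {false} {false} f g = refl
bool-ext {false} {true}  f g = g refl

∨-introʳ : ∀ x {y} → y ≡ true → x ∨ y ≡ true
∨-introʳ x refl = Bool.∨-zeroʳ x

-- Connectivity and components of edge sets

module Connectivity (G : SignedGraph) where
  open SignedGraphParity G public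

  infix 4 _⊆_
  _⊆_ : EdgeSet G → EdgeSet G → Set
  S ⊆ T = ∀ e → S e ≡ true → T e ≡ true

  NonEmpty : EdgeSet G → Set
  NonEmpty S = Σ (Fin nE) λ e → S e ≡ true

  incident : ∀ {S} e i → S e ≡ true → Incident G S (end e i)
  incident e i Se = e , i , Se , refl

  reach-trans : ∀ {S u v w} → Reach G S u v → Reach G S v w → Reach G S u w
  reach-trans p here          = p
  reach-trans p (step i j h q) = step i j h (reach-trans p q)

  reach-sym : ∀ {S u v} → Reach G S u v → Reach G S v u
  reach-sym here           = here
  reach-sym (step i j h p) = reach-trans (step j i h here) (reach-sym p)

  reach-mono : ∀ {S T} → S ⊆ T → ∀ {u v} → Reach G S u v → Reach G T u v
  reach-mono S⊆T here               = here
  reach-mono S⊆T (step {e} i j h p) = step i j (S⊆T e h) (reach-mono S⊆T p)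

  connectedFrom : ∀ {S} c → (∀ u → Incident G S u → Reach G S c u) → ConnectedSub G S
  connectedFrom c h u v iu iv = reach-trans (reach-sym (h u iu)) (h v iv)

  odd⇒NonEmpty : ∀ {S} → negParity S ≡ true → NonEmpty S
  odd⇒NonEmpty {S} odd with ⨁-differ (λ e → S e ∧ neg e) (λ _ → false)
    (λ h → true≢false odd (trans h (⨁-zero {nE} (λ _ → false) (λ _ → refl))))
  ... | e , h = e , proj₁ (∧-true {S e} (≢false⇒true h))

  △-⊆ : ∀ {S T} → T ⊆ S → (S △ T) ⊆ S
  △-⊆ {S} {T} T⊆S e h with S e in Se | T e in Te
  ... | true  | _    = refl
  ... | false | true = contradiction Se (true≢false (T⊆S e Te))

  △-disjoint : ∀ {S T} → T ⊆ S → ∀ e → T e ≡ true → (S △ T) e ≡ false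
  △-disjoint T⊆S e Te rewrite Te | T⊆S e Te = refl

  △-true : ∀ {S T} e → S e ≡ true → T e ≡ false → (S △ T) e ≡ true
  △-true e Se Te rewrite Se | Te = refl

  △-smaller : ∀ {S T} → T ⊆ S → NonEmpty T → count (S △ T) < count S
  △-smaller {S} {T} T⊆S (e , Te) =
    count-strict (△-⊆ {S} {T} T⊆S) e (△-disjoint {S} {T} T⊆S e Te) (T⊆S e Te)

  -- K is a union of components of S.
  Saturated : EdgeSet G → EdgeSet G → Set
  Saturated S K = Σ (Fin nV → Bool) λ X → ∀ e i → K e ≡ S e ∧ X (end e i)

  saturated-⊆ : ∀ {S K} → Saturated S K → K ⊆ S
  saturated-⊆ {S} (X , h) e Ke = proj₁ (∧-true {S e} (trans (sym (h e zero)) Ke))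

  -- The bits `a` and `b` say which ends of the edge are at the vertex. An edge with an end there is
  -- in `K` as `x` and `y` dictate; any other contributes zero on both sides.
  degree-term : ∀ k a b x y → (a ≡ true → k ≡ y ∧ x) → (b ≡ true → k ≡ y ∧ x) →
    let d = (if a then 1 else 0) ℕ.+ ((if b then 1 else 0) ℕ.+ 0)
    in (if k then d else 0) ≡ (if x then (if y then d else 0) else 0)
  degree-term k true b x y h _ rewrite h refl with x | y
  ... | true  | true  = refl
  ... | true  | false = refl
  ... | false | true  = refl
  ... | false | false = refl
  degree-term k false true x y _ h rewrite h refl with x | y
  ... | true  | true  = refl
  ... | true  | false = refl
  ... | false | true  = refl
  ... | false | false = refl
  degree-term false false false true true _ _ = refl
  degree-term false false false true false _ _ = refl
  degree-term false false false false _ _ _ = refl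
  degree-term true false false true true _ _ = refl
  degree-term true false false true false _ _ = refl
  degree-term true false false false _ _ _ = refl

  deg-saturated : ∀ {S K} ((X , _) : Saturated S K) v →
                  deg G K v ≡ (if X v then deg G S v else 0)
  deg-saturated {S} {K} (X , h) v = trans
    (sumℕ-cong (λ e → degree-term (K e) (s e == v) (t e == v) (X v) (S e)
                        (λ eq → trans (h e zero) (cong (λ u → S e ∧ X u) (==-true eq)))
                        (λ eq → trans (h e (suc zero)) (cong (λ u → S e ∧ X u) (==-true eq)))))
    (pull (X v))
    where
    term : Fin nE → ℕ
    term e = if S e then sumℕ (λ i → if does (end e i ≟ v) then 1 else 0) else 0
    pull : ∀ x → sumℕ (λ e → if x then term e else 0) ≡ (if x then sumℕ term else 0)
    pull true  = refl
    pull false = sumℕ-zero {nE} (λ _ → 0) (λ _ → refl)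

  saturated-even : ∀ {S K} → Saturated S K → EvenDegrees S → EvenDegrees K
  saturated-even {S} {K} sat@(X , _) even v = begin
      ∂ K v                                 ≡⟨ sym (parity-deg K v) ⟩
      parity (deg G K v)                    ≡⟨ cong parity (deg-saturated {S} {K} sat v) ⟩
      parity (if X v then deg G S v else 0) ≡⟨ parity-if (X v) (deg G S v) ⟩
      X v ∧ parity (deg G S v)              ≡⟨ cong (X v ∧_) (trans (parity-deg S v) (even v)) ⟩
      X v ∧ false                           ≡⟨ Bool.∧-zeroʳ (X v) ⟩
      false                                 ∎
    where open ≡-Reasoning

  -- A decidable form of `Reach`: closure under edges makes it complete, the last component makes it
  -- sound.
  ReachableSet : EdgeSet G → Fin nV → Set
  ReachableSet S u = Σ (Fin nV → Bool) λ X →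
    X u ≡ true ×
    (∀ e i j → S e ≡ true → X (end e i) ≡ true → X (end e j) ≡ true) ×
    (∀ v → X v ≡ true → Reach G S u v)

  -- The set grows from `u` by the far ends of edges that leave it; the number of vertices outside
  -- bounds the growth.
  reachableSet : ∀ S u → ReachableSet S u
  reachableSet S u = grow (suc (count (not ∘ (u ==_)))) (u ==_) ℕ.≤-refl (==-refl u)
                       (λ v h → subst (Reach G S u) (==-true h) here)
    where
    grow : ∀ bound X → count (not ∘ X) < bound → X u ≡ true →
           (∀ v → X v ≡ true → Reach G S u v) → ReachableSet S u
    grow (suc bound) X (s≤s size) Xu reach
      with any? (λ e → any? (λ i → any? (λ j → (S e Bool.≟ true) ×-dec
             ((X (end e i) Bool.≟ true) ×-dec (X (end e j) Bool.≟ false)))))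
    ... | no none = X , Xu , closed , reach
      where
      closed : ∀ e i j → S e ≡ true → X (end e i) ≡ true → X (end e j) ≡ true
      closed e i j Se Xi = ≢false⇒true (λ Xj → none (e , i , j , Se , Xi , Xj))
    ... | yes (e , i , j , Se , Xi , Xj) =
      grow bound X′ (ℕ.<-≤-trans smaller size) (cong (_∨ end e j == u) Xu) reach′
      where
      X′ : Fin nV → Bool
      X′ v = X v ∨ end e j == v
      smaller : count (not ∘ X′) < count (not ∘ X)
      smaller = count-strict
        (λ v h → trans (sym (Bool.∧-identityʳ _)) (helper (X v) (end e j == v) h)) (end e j)
        (cong not (trans (cong (X (end e j) ∨_) (==-refl (end e j))) (Bool.∨-zeroʳ _)))
        (cong not Xj)
        where
        helper : ∀ a b → not (a ∨ b) ≡ true → not a ∧ true ≡ true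
        helper false b _ = refl
      reach′ : ∀ v → X′ v ≡ true → Reach G S u v
      reach′ v h with X v in Xv
      ... | true  = reach v Xv
      ... | false = subst (Reach G S u) (==-true h) (step i j Se (reach (end e i) Xi))

  componentAt : ∀ S u → Σ (EdgeSet G) λ K → Saturated S K × ConnectedSub G K ×
                (∀ e i → S e ≡ true → Reach G S u (end e i) → K e ≡ true)
  componentAt S u with reachableSet S u
  ... | X , Xu , closed , reach = K , (X , saturated) , connected , contains
    where
    K : EdgeSet G
    K e = S e ∧ X (s e)
    saturated : ∀ e i → K e ≡ S e ∧ X (end e i)
    saturated e i with S e in Se
    ... | false = refl
    ... | true  = bool-ext (closed e zero i Se) (closed e i zero Se)
    -- A walk of `S` that starts at `u` never leaves `X`, so it is already a walk of `K`.
    restrict : ∀ {v} → Reach G S u v → X v ≡ true × Reach G K u v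
    restrict here = Xu , here
    restrict (step {e} i j Se r) with restrict r
    ... | Xi , r′ = closed e i j Se Xi ,
      step i j (trans (saturated e i) (cong₂ _∧_ Se Xi)) r′
    connected : ConnectedSub G K
    connected = connectedFrom u λ { _ (e , i , Ke , refl) →
      proj₂ (restrict (reach (end e i) (proj₂ (∧-true {S e} (trans (sym (saturated e i)) Ke))))) }
    contains : ∀ e i → S e ≡ true → Reach G S u (end e i) → K e ≡ true
    contains e i Se r = trans (saturated e i) (cong₂ _∧_ Se (proj₁ (restrict r)))

  OddComponent : EdgeSet G → Set
  OddComponent S = Σ (EdgeSet G) λ K → Saturated S K × ConnectedSub G K × negParity K ≡ true

  -- Even components are stripped off one after another. The rest stays odd, hence nonempty, while
  -- it shrinks, so an odd component is met.
  odd-component : ∀ S → negParity S ≡ true → OddComponent S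
  odd-component S = search (suc (count S)) S ℕ.≤-refl
    where
    search : ∀ bound S → count S < bound → negParity S ≡ true → OddComponent S
    search (suc bound) S (s≤s size) odd with odd⇒NonEmpty {S} odd
    ... | e , Se with componentAt S (s e)
    ... | K , sat@(X , h) , connected , contains with negParity K in parityK
    ... | true  = K , sat , connected , parityK
    ... | false with search bound (S △ K)
          (ℕ.<-≤-trans (△-smaller {S} {K} (saturated-⊆ {S} {K} sat) (e , contains e zero Se here))
                     size)
          (△-parity {S} {K} odd parityK)
    ... | K′ , (X′ , h′) , connected′ , odd′ =
      -- `X′` is only known to cut `K′` out of `S △ K`; discarding the vertices of `X` makes it cut
      -- `K′` out of `S`.
      K′ , ((λ v → X′ v ∧ not (X v)) , saturated′) , connected′ , odd′
      where
      saturated′ : ∀ e i → K′ e ≡ S e ∧ (X′ (end e i) ∧ not (X (end e i)))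
      saturated′ e i = trans (h′ e i) (trans (cong (λ k → (S e xor k) ∧ X′ (end e i)) (h e i))
        (taut 3 (λ y x x′ → (y xor (y ∧ x)) ∧ x′) (λ y x x′ → y ∧ (x′ ∧ not x)) refl
                (S e) (X (end e i)) (X′ (end e i))))

  -- Every component of S \ C meets C, so removing some of them keeps the rest attached to C.
  connected-remainder : ∀ {S C K} → ConnectedSub G S → ConnectedSub G C → NonEmpty C → C ⊆ S →
                        Saturated (S △ C) K → ConnectedSub G (S △ K)
  connected-remainder {S} {C} {K} connS connC (e₀ , Ce₀) C⊆S (X , h) = connectedFrom c₀ from-c₀
    where
    c₀ : Fin nV
    c₀ = s e₀
    in-C⇒not-in-K : ∀ e → C e ≡ true → K e ≡ false
    in-C⇒not-in-K e Ce = trans (h e zero) (cong (_∧ X (s e)) (△-disjoint {S} {C} C⊆S e Ce))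
    C⊆rest : C ⊆ S △ K
    C⊆rest e Ce = △-true {S} {K} e (C⊆S e Ce) (in-C⇒not-in-K e Ce)
    reach-C : ∀ e i → C e ≡ true → Reach G (S △ K) c₀ (end e i)
    reach-C e i Ce = reach-mono {C} C⊆rest
      (connC c₀ (end e i) (incident e₀ zero Ce₀) (incident e i Ce))
    K-outside-C : ∀ e i → S e ≡ true → C e ≡ false → K e ≡ X (end e i)
    K-outside-C e i Se Ce = trans (h e i) (cong (_∧ X (end e i)) (△-true {S} {C} e Se Ce))
    -- An edge of `C` leads back to the connected set `C`. An edge of `S` outside `C` has both ends
    -- in `X` or neither, so it never joins the two alternatives.
    explore : ∀ {y} → Reach G S c₀ y → X y ≡ true ⊎ Reach G (S △ K) c₀ y
    explore here = inj₂ here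
    explore (step {e} i j Se r) with C e in Ce
    ... | true  = inj₂ (reach-C e j Ce)
    ... | false with X (end e j) in Xj | explore r
    ...   | true  | _       = inj₁ refl
    ...   | false | inj₂ r′ = inj₂ (step i j (△-true {S} {K} e Se
              (trans (K-outside-C e j Se Ce) Xj)) r′)
    ...   | false | inj₁ Xi = contradiction
              (trans (sym (K-outside-C e j Se Ce)) (trans (K-outside-C e i Se Ce) Xi))
              (λ h → true≢false h Xj)
    from-c₀ : ∀ u → Incident G (S △ K) u → Reach G (S △ K) c₀ u
    from-c₀ _ (e , i , Re , refl) with C e in Ce
    ... | true  = reach-C e i Ce
    ... | false with explore (connS c₀ (end e i) (incident {S} e₀ zero (C⊆S e₀ Ce₀))
                                (incident {S} e i Se))
      where
      K⊆S : K ⊆ S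
      K⊆S e Ke = △-⊆ {S} {C} C⊆S e (saturated-⊆ {S △ C} {K} (X , h) e Ke)
      Se : S e ≡ true
      Se = △-⊆ {S} {K} K⊆S e Re
    ...   | inj₂ r  = r
    ...   | inj₁ Xi = contradiction Re (λ Re → true≢false Re
              (△-disjoint {S} {K} K⊆S e (trans (K-outside-C e i (△-⊆ {S} {K} K⊆S e Re) Ce) Xi)))
      where
      K⊆S : K ⊆ S
      K⊆S e Ke = △-⊆ {S} {C} C⊆S e (saturated-⊆ {S △ C} {K} (X , h) e Ke)

  Touching : EdgeSet G → EdgeSet G → Set
  Touching A B = Σ (Fin nV) λ x → Incident G A x × Incident G B x

  -- A walk from `a` to `b` stays incident with `A` until it takes an edge of `B`; failing that, it
  -- is still incident with `A` when it arrives at `b`.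
  cover-touching : ∀ {A B} → (∀ u v → Reach G (allEdges G) u v) → NonEmpty A → NonEmpty B →
                   (∀ e → A e ≡ true ⊎ B e ≡ true) → Touching A B
  cover-touching {A} {B} connected (a , Aa) (b , Bb) cover
    with explore (connected (s a) (s b))
    where
    explore : ∀ {y} → Reach G (allEdges G) (s a) y → Touching A B ⊎ Incident G A y
    explore here = inj₂ (incident a zero Aa)
    explore (step {e} i j _ r) with explore r | cover e
    ... | inj₁ touch | _       = inj₁ touch
    ... | inj₂ _     | inj₁ Ae = inj₂ (incident e j Ae)
    ... | inj₂ incA  | inj₂ Be = inj₁ (end e i , incA , incident e i Be)
  ... | inj₁ touch = touch
  ... | inj₂ incA  = s b , incA , incident b zero Bb

  union-connected : ∀ {A B U} → ConnectedSub G A → ConnectedSub G B → Touching A B →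
                    A ⊆ U → B ⊆ U → (∀ e → U e ≡ true → A e ≡ true ⊎ B e ≡ true) →
                    ConnectedSub G U
  union-connected {A} {B} {U} connA connB (x , incA , incB) A⊆U B⊆U U⊆A∪B = connectedFrom x from-x
    where
    from-x : ∀ u → Incident G U u → Reach G U x u
    from-x _ (e , i , Ue , refl) with U⊆A∪B e Ue
    ... | inj₁ Ae = reach-mono {A} A⊆U (connA x (end e i) incA (incident e i Ae))
    ... | inj₂ Be = reach-mono {B} B⊆U (connB x (end e i) incB (incident e i Be))

-- Walks, closed trails and the extraction of odd circuits

half : Bool → ℕ
half b = if b then 1 else 0

half-* : ∀ b n → half b ℕ.* n ≡ (if b then n else 0)
half-* true  n = ℕ.+-identityʳ n
half-* false n = refl

parity-half : ∀ b → parity (half b) ≡ b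
parity-half true  = refl
parity-half false = refl

≤half⇒half-parity : ∀ {n} b → n ≤ half b → half (parity n) ≡ n
≤half⇒half-parity {zero}        _    _         = refl
≤half⇒half-parity {suc zero}    _    _         = refl
≤half⇒half-parity {suc (suc _)} true (s≤s ())

≤half⇒true : ∀ {n} b → n ≤ half b → n ≢ 0 → b ≡ true
≤half⇒true true  _   _   = refl
≤half⇒true false z≤n n≢0 = contradiction refl n≢0

flip : Fin 2 → Fin 2
flip zero    = suc zero
flip (suc _) = zero

module Walks (G : SignedGraph) where
  open Connectivity G public

  data Walk : Fin nV → Fin nV → Set where
    []   : ∀ {u} → Walk u u
    step : ∀ {u w} e i → end e i ≡ u → Walk (end e (flip i)) w → Walk u w

  mult : ∀ {u w} → Walk u w → Fin nE → ℕ
  mult []             x = 0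
  mult (step e _ _ W) x = half (e == x) ℕ.+ mult W x

  -- Says that the walk is a trail in `R`: it uses no edge outside `R` and no edge twice.
  Within : ∀ {u w} → Walk u w → EdgeSet G → Set
  Within W R = ∀ e → mult W e ≤ half (R e)

  -- Taken modulo 2, so that `∂-trace` holds for every walk; for a trail it is the set of its edges.
  trace : ∀ {u w} → Walk u w → EdgeSet G
  trace W e = parity (mult W e)

  incidence : Fin nE → Fin nV → ℕ
  incidence e x = half (s e == x) ℕ.+ (half (t e == x) ℕ.+ 0)

  -- Counts half-edges at `x` rather than passages, so for a trail it is the degree of `x` in the
  -- trace.
  visits : ∀ {u w} → Walk u w → Fin nV → ℕ
  visits []             x = 0
  visits (step e _ _ W) x = incidence e x ℕ.+ visits W x

  incidence-end : ∀ e i x → incidence e x ≡ half (end e i == x) ℕ.+ half (end e (flip i) == x)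
  incidence-end e zero x = cong (half (s e == x) ℕ.+_) (ℕ.+-identityʳ _)
  incidence-end e (suc zero) x = trans (cong (half (s e == x) ℕ.+_) (ℕ.+-identityʳ _))
                                       (ℕ.+-comm (half (s e == x)) _)

  star-ends : ∀ e i x → star s t x e ≡ end e i == x xor end e (flip i) == x
  star-ends e zero       x = refl
  star-ends e (suc zero) x = Bool.xor-comm (s e == x) _

  star-end : ∀ {w} e → star s t w e ≡ true → Σ (Fin 2) λ i → end e i ≡ w × end e (flip i) ≢ w
  star-end {w} e h with s e ≟ w | t e ≟ w
  ... | yes p | no q  = zero , p , q
  ... | no p  | yes q = suc zero , q , p

  within⇒mult : ∀ {u w} (W : Walk u w) {R} → Within W R → ∀ e → half (trace W e) ≡ mult W e
  within⇒mult W {R} within e = ≤half⇒half-parity (R e) (within e)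

  trace-⊆ : ∀ {u w} (W : Walk u w) {R} → Within W R → trace W ⊆ R
  trace-⊆ W {R} within e h = ≤half⇒true (R e) (within e)
    (λ mult≡0 → true≢false h (cong parity mult≡0))

  ∂-singleton : ∀ e v → ∂ (e ==_) v ≡ star s t v e
  ∂-singleton e v = trans (⨁-cong (λ x → Bool.∧-comm (e == x) (star s t v x)))
                          (⨁-evaluate (star s t v) e)

  ∂-trace : ∀ {u w} (W : Walk u w) x → ∂ (trace W) x ≡ u == x xor w == x
  ∂-trace {u} [] x = trans (⨁-zero {nE} (λ _ → false) (λ _ → refl)) (sym (Bool.xor-same (u == x)))
  ∂-trace {w = w} (step e i refl W) x = begin
      ∂ (trace (step e i refl W)) x
    ≡⟨ ∂-cong {S = trace (step e i refl W)} {T = (e ==_) △ trace W}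
         (λ y → trans (parity-+ (half (e == y)) (mult W y))
                      (cong (_xor trace W y) (parity-half (e == y)))) x ⟩
      ∂ ((e ==_) △ trace W) x
    ≡⟨ ∂-△ (e ==_) (trace W) x ⟩
      ∂ (e ==_) x xor ∂ (trace W) x
    ≡⟨ cong₂ _xor_ (trans (∂-singleton e x) (star-ends e i x)) (∂-trace W x) ⟩
      (end e i == x xor end e (flip i) == x) xor (end e (flip i) == x xor w == x)
    ≡⟨ taut 3 (λ a b c → (a xor b) xor (b xor c)) (λ a b c → a xor c) refl
         (end e i == x) (end e (flip i) == x) (w == x) ⟩
      end e i == x xor w == x ∎
    where open ≡-Reasoning

  visits-sum : ∀ {u w} (W : Walk u w) x → visits W x ≡ ∑ⁿ (λ e → mult W e ℕ.* incidence e x)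
  visits-sum [] x = sym (∑ⁿ-zero {nE} (λ _ → 0) (λ _ → refl))
  visits-sum (step e i _ W) x = sym (begin
      ∑ⁿ (λ y → (half (e == y) ℕ.+ mult W y) ℕ.* incidence y x)
    ≡⟨ ∑ⁿ-cong (λ y → ℕ.*-distribʳ-+ (incidence y x) (half (e == y)) (mult W y)) ⟩
      ∑ⁿ (λ y → half (e == y) ℕ.* incidence y x ℕ.+ mult W y ℕ.* incidence y x)
    ≡⟨ ∑ⁿ-+ (λ y → half (e == y) ℕ.* incidence y x) (λ y → mult W y ℕ.* incidence y x) ⟩
      ∑ⁿ (λ y → half (e == y) ℕ.* incidence y x) ℕ.+ ∑ⁿ (λ y → mult W y ℕ.* incidence y x)
    ≡⟨ cong₂ ℕ._+_
         (trans (∑ⁿ-single (λ y → half (e == y) ℕ.* incidence y x) e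
                  (λ y e≢y → cong (λ b → half b ℕ.* incidence y x) (==-≢ e≢y)))
                (trans (cong (λ b → half b ℕ.* incidence e x) (==-refl e)) (ℕ.*-identityˡ _)))
         (sym (visits-sum W x)) ⟩
      incidence e x ℕ.+ visits W x ∎)
    where open ≡-Reasoning

  deg-trace : ∀ {u w} (W : Walk u w) {R} → Within W R → ∀ x → deg G (trace W) x ≡ visits W x
  deg-trace W within x = trans
    (sumℕ≡∑ⁿ (λ e → if trace W e then incidence e x else 0))
    (trans (∑ⁿ-cong (λ e → trans (sym (half-* (trace W e) (incidence e x)))
                                 (cong (ℕ._* incidence e x) (within⇒mult W within e))))
           (sym (visits-sum W x)))

  singleton-⊆ : ∀ {R : EdgeSet G} e → R e ≡ true → (e ==_) ⊆ R
  singleton-⊆ {R} e Re x h = subst (λ y → R y ≡ true) (==-true h) Re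

  within-step : ∀ {u w R} e i (eq : end e i ≡ u) (W : Walk (end e (flip i)) w) →
                R e ≡ true → Within W (R △ (e ==_)) → Within (step e i eq W) R
  within-step {R = R} e i eq W Re within x with e ≟ x | within x
  ... | yes refl | h rewrite Re = s≤s h
  ... | no _     | h = subst (λ b → mult W x ≤ half b) (Bool.xor-identityʳ (R x)) h

  simple-path : ∀ bound R {v w} → count R < bound → w ≢ v → (∀ x → ∂ R x ≡ w == x xor v == x) →
                Σ (Walk w v) λ W → Within W R × visits W v ≡ 1
  simple-path (suc bound) R {v} {w} (s≤s size) w≢v ∂R
    with ⨁-differ (λ e → R e ∧ star s t w e) (λ _ → false) (λ h → true≢false
           (trans (∂R w) (cong₂ _xor_ (==-refl w) (==-≢ (w≢v ∘ sym))))
           (trans h (⨁-zero {nE} (λ _ → false) (λ _ → refl))))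
  ... | e , h with ∧-true {R e} (≢false⇒true h)
  ... | Re , we with star-end e we
  ... | i , refl , y≢w with end e (flip i) ≟ v
  ... | yes refl = step e i refl [] , within-step e i refl [] Re (λ _ → z≤n) ,
    trans (ℕ.+-identityʳ _) (trans (incidence-end e i v)
      (cong₂ (λ a b → half a ℕ.+ half b) (==-≢ w≢v) (==-refl v)))
  ... | no y≢v with simple-path bound (R △ (e ==_))
      (ℕ.<-≤-trans (△-smaller {R} {e ==_} (singleton-⊆ {R} e Re) (e , ==-refl e)) size) y≢v
      (λ x → trans (∂-△ R (e ==_) x)
        (trans (cong₂ _xor_ (∂R x) (trans (∂-singleton e x) (star-ends e i x)))
               (taut 3 (λ a b c → (a xor b) xor (a xor c)) (λ a b c → c xor b) refl
                       (end e i == x) (v == x) (end e (flip i) == x))))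
  ... | W , within , visits-v = step e i refl W , within-step e i refl W Re within ,
    trans (cong₂ ℕ._+_ (trans (incidence-end e i v)
            (cong₂ (λ a b → half a ℕ.+ half b) (==-≢ w≢v) (==-≢ y≢v))) refl) visits-v

  -- A loop is itself a closed trail. Without a non-loop `e`, the ends of `e` are the only vertices
  -- of odd degree, and `simple-path` leads back from one to the other. The exact degree 2 at the
  -- start shows in `odd-circuit` that the trail is not all of `M`.
  closed-trail : ∀ {M} → EvenDegrees M → ∀ e i → M e ≡ true →
                 Σ (Walk (end e i) (end e i)) λ W → Within W M × visits W (end e i) ≡ 2
  closed-trail {M} even e i Me with end e (flip i) ≟ end e i
  ... | yes loop = step e i refl (back loop) ,
    within-step e i refl (back loop) Me (back-within loop) ,
    trans (cong₂ ℕ._+_ (trans (incidence-end e i (end e i))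
      (cong₂ (λ a b → half a ℕ.+ half b) (==-refl (end e i))
             (trans (cong (_== end e i) loop) (==-refl (end e i))))) (back-visits loop)) refl
    where
    back : ∀ {u w} → u ≡ w → Walk u w
    back refl = []
    back-within : ∀ {u w} (p : u ≡ w) {R} → Within (back p) R
    back-within refl _ = z≤n
    back-visits : ∀ {u w} (p : u ≡ w) {x} → visits (back p) x ≡ 0
    back-visits refl = refl
  ... | no y≢v with simple-path (suc (count (M △ (e ==_)))) (M △ (e ==_)) ℕ.≤-refl y≢v
      (λ x → trans (∂-△ M (e ==_) x)
        (trans (cong₂ _xor_ (even x) (trans (∂-singleton e x) (star-ends e i x)))
               (Bool.xor-comm (end e i == x) (end e (flip i) == x))))
  ... | W , within , visits-v = step e i refl W , within-step e i refl W Me within ,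
    cong₂ ℕ._+_ (trans (incidence-end e i (end e i))
      (cong₂ (λ a b → half a ℕ.+ half b) (==-refl (end e i)) (==-≢ y≢v))) visits-v

  deg≢0⇒Incident : ∀ S v → deg G S v ≢ 0 → Incident G S v
  deg≢0⇒Incident S v h
    with ¬∀⟶∃¬ nE _ (λ e → (if S e then incidence e v else 0) ℕ.≟ 0) (h ∘ sumℕ-zero _)
  ... | e , h′ with S e in Se
  ... | false = contradiction refl h′
  ... | true with s e ≟ v | t e ≟ v
  ... | yes p | _     = e , zero , Se , p
  ... | no _  | yes q = e , suc zero , Se , q
  ... | no _  | no _  = contradiction refl h′

  deg-cong : ∀ {S T} → S ≗ T → ∀ v → deg G S v ≡ deg G T v
  deg-cong S≗T v = sumℕ-cong (λ e → cong (λ b → if b then incidence e v else 0) (S≗T e))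

  -- If all degrees are 0 or 2, an odd component is a circuit. Otherwise a closed trail through a
  -- vertex of another degree splits `M` into two smaller sets with even degrees, and one of them is
  -- odd.
  odd-circuit : ∀ bound M → count M < bound → EvenDegrees M → negParity M ≡ true →
                Σ (EdgeSet G) λ C → Circuit G C × negParity C ≡ true × C ⊆ M
  odd-circuit (suc bound) M (s≤s size) even odd
    with all? (λ v → (deg G M v ℕ.≟ 0) ⊎-dec (deg G M v ℕ.≟ 2))
  ... | yes two-regular with odd-component M odd
  ... | K , sat@(X , h) , connected , oddK =
    K , (odd⇒NonEmpty {K} oddK , K-degrees , connected) , oddK , saturated-⊆ {M} {K} sat
    where
    K-degrees : ∀ v → deg G K v ≡ 0 ⊎ deg G K v ≡ 2
    K-degrees v with X v | deg-saturated {M} {K} sat v | two-regular v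
    ... | true  | eq | inj₁ d = inj₁ (trans eq d)
    ... | true  | eq | inj₂ d = inj₂ (trans eq d)
    ... | false | eq | _      = inj₁ eq
  odd-circuit (suc bound) M (s≤s size) even odd | no irregular
    with ¬∀⟶∃¬ nV _ (λ v → (deg G M v ℕ.≟ 0) ⊎-dec (deg G M v ℕ.≟ 2)) irregular
  ... | v , irregular-v with deg≢0⇒Incident M v (irregular-v ∘ inj₁)
  ... | e , i , Me , refl with closed-trail {M} even e i Me
  ... | W , within , visits-v = by-parity (negParity T) refl
    where
    T : EdgeSet G
    T = trace W
    deg-T : deg G T v ≡ 2
    deg-T = trans (deg-trace W within v) visits-v
    T⊆M : T ⊆ M
    T⊆M = trace-⊆ W within
    T-even : EvenDegrees T
    T-even x = trans (∂-trace W x) (Bool.xor-same (v == x))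
    T-NonEmpty : NonEmpty T
    T-NonEmpty with deg≢0⇒Incident T v (λ h → contradiction (trans (sym deg-T) h) (λ ()))
    ... | e , _ , Te , _ = e , Te
    T-smaller : count T < count M
    T-smaller with ¬∀⟶∃¬ nE _ (λ x → T x Bool.≟ M x)
      (λ T≗M → irregular-v (inj₂ (trans (sym (deg-cong {T} {M} T≗M v)) deg-T)))
    ... | x , Tx≢Mx with T x in Tx | M x in Mx
    ... | true  | true  = contradiction refl Tx≢Mx
    ... | true  | false = contradiction Mx (true≢false (T⊆M x Tx))
    ... | false | true  = count-strict T⊆M x Tx Mx
    ... | false | false = contradiction refl Tx≢Mx
    by-parity : ∀ b → negParity T ≡ b → Σ (EdgeSet G) λ C → Circuit G C × negParity C ≡ true × C ⊆ M
    by-parity true oddT with odd-circuit bound T (ℕ.<-≤-trans T-smaller size) T-even oddT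
    ... | C , circuit , oddC , C⊆T = C , circuit , oddC , λ x → T⊆M x ∘ C⊆T x
    by-parity false evenT with odd-circuit bound (M △ T)
      (ℕ.<-≤-trans (△-smaller {M} {T} T⊆M T-NonEmpty) size) (△-even {M} {T} even T-even)
      (△-parity {M} {T} odd evenT)
    ... | C , circuit , oddC , C⊆ = C , circuit , oddC , λ x → △-⊆ {M} {T} T⊆M x ∘ C⊆ x

-- Eulerian decompositions, even unions and disjoint unbalanced circuits

module Decompositions (G : SignedGraph) where
  open Walks G public

  OddEulerian : EdgeSet G → Set
  OddEulerian H = ConnectedSub G H × EvenDegrees H × negParity H ≡ true

  Exclusive : EdgeSet G → EdgeSet G → Set
  Exclusive A B = ∀ e → A e ≡ true → B e ≡ false

  exclusive-sym : ∀ {A B} → Exclusive A B → Exclusive B A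
  exclusive-sym {A} excl e Be with A e in Ae
  ... | false = refl
  ... | true  = contradiction (excl e Ae) (true≢false Be)

  ExactlyOne : (H₁ H₂ H₃ : EdgeSet G) → Set
  ExactlyOne H₁ H₂ H₃ = ∀ e → (H₁ e ≡ true × H₂ e ≡ false × H₃ e ≡ false)
                            ⊎ (H₁ e ≡ false × H₂ e ≡ true × H₃ e ≡ false)
                            ⊎ (H₁ e ≡ false × H₂ e ≡ false × H₃ e ≡ true)

  decomposition : ∀ H₁ H₂ H₃ → OddEulerian H₁ → OddEulerian H₂ → OddEulerian H₃ →
                  ExactlyOne H₁ H₂ H₃ → DecompThreeOddEulerian G
  decomposition H₁ H₂ H₃ (c₁ , e₁ , o₁) (c₂ , e₂ , o₂) (c₃ , e₃ , o₃) exactly-one =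
    H₁ , H₂ , H₃ , (c₁ , ∂⇒Even-deg {H₁} e₁) , (c₂ , ∂⇒Even-deg {H₂} e₂) ,
    (c₃ , ∂⇒Even-deg {H₃} e₃) , negParity⇒Odd {H₁} o₁ , negParity⇒Odd {H₂} o₂ ,
    negParity⇒Odd {H₃} o₃ , exactly-one

  circuit-even : ∀ {C} → Circuit G C → EvenDegrees C
  circuit-even {C} (_ , degrees , _) v = trans (sym (parity-deg C v)) (even (degrees v))
    where
    even : ∀ {n} → n ≡ 0 ⊎ n ≡ 2 → parity n ≡ false
    even (inj₁ refl) = refl
    even (inj₂ refl) = refl

  exactly-one-rest : ∀ {a b} → (b ≡ true → a ≢ true) →
    let c = true xor (a xor b) in
    (a ≡ true × b ≡ false × c ≡ false) ⊎ (a ≡ false × b ≡ true × c ≡ false) ⊎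
    (a ≡ false × b ≡ false × c ≡ true)
  exactly-one-rest {true}  {true}  h = contradiction refl (h refl)
  exactly-one-rest {true}  {false} _ = inj₁ (refl , refl , refl)
  exactly-one-rest {false} {true}  _ = inj₂ (inj₁ (refl , refl , refl))
  exactly-one-rest {false} {false} _ = inj₂ (inj₂ (refl , refl , refl))

  exactly-one-nested : ∀ {b k} → (b ≡ true → k ≡ true) →
    let k-b = k xor b ; rest = true xor k in
    (b ≡ true × k-b ≡ false × rest ≡ false) ⊎ (b ≡ false × k-b ≡ true × rest ≡ false) ⊎
    (b ≡ false × k-b ≡ false × rest ≡ true)
  exactly-one-nested {true}  {true}  _ = inj₁ (refl , refl , refl)
  exactly-one-nested {true}  {false} h = contradiction (h refl) (λ ())
  exactly-one-nested {false} {true}  _ = inj₂ (inj₁ (refl , refl , refl))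
  exactly-one-nested {false} {false} _ = inj₂ (inj₂ (refl , refl , refl))

  private
    A : EdgeSet G
    A = allEdges G

  module _ (connected : ∀ u v → Reach G (allEdges G) u v) (even : EvenDegrees (allEdges G))
           (odd : negParity (allEdges G) ≡ true) where

    A-connected : ConnectedSub G A
    A-connected u v _ _ = connected u v

    module _ {C₁} (circuit₁ : Circuit G C₁) (odd₁ : negParity C₁ ≡ true) where

      R : EdgeSet G
      R = A △ C₁

      R-even : EvenDegrees R
      R-even = △-even {A} {C₁} even (circuit-even {C₁} circuit₁)

      R-parity : negParity R ≡ false
      R-parity = △-parity {A} {C₁} odd odd₁

      remainder-connected : ∀ {K} → Saturated R K → ConnectedSub G (A △ K)
      remainder-connected {K} = connected-remainder {A} {C₁} {K} A-connected
        (proj₂ (proj₂ circuit₁)) (proj₁ circuit₁) (λ _ _ → refl)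

      -- `K` and `K₂` together are a union of components of `R`, so the rest is held together by
      -- `C₁`; it is odd because the whole graph and both parts are.
      odd-component⇒decomposition : ∀ {K} → Saturated R K → ConnectedSub G K →
        negParity K ≡ true → OddComponent (R △ K) → DecompThreeOddEulerian G
      odd-component⇒decomposition {K} satK@(X , hX) connK oddK
        (K₂ , satK₂@(X₂ , hX₂) , connK₂ , oddK₂) =
        decomposition K K₂ (A △ (K △ K₂))
          (connK , K-even , oddK)
          (connK₂ , K₂-even , oddK₂)
          -- The union of `X` and `X₂`, written as a disjoint one to match `K △ K₂`.
          ( remainder-connected {K △ K₂} ((λ v → X v xor (not (X v) ∧ X₂ v)) , saturated)
          , △-even {A} {K △ K₂} even (△-even {K} {K₂} K-even K₂-even)
          , △-parity {A} {K △ K₂} odd (△-parity {K} {K₂} oddK oddK₂))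
          exactly-one
        where
        K-even : EvenDegrees K
        K-even = saturated-even {R} {K} satK R-even
        K₂-even : EvenDegrees K₂
        K₂-even = saturated-even {R △ K} {K₂} satK₂ (△-even {R} {K} R-even K-even)
        saturated : ∀ e i → (K △ K₂) e ≡ R e ∧ (X (end e i) xor (not (X (end e i)) ∧ X₂ (end e i)))
        saturated e i = trans
          (cong₂ _xor_ (hX e i) (trans (hX₂ e i) (cong (λ k → (R e xor k) ∧ X₂ (end e i)) (hX e i))))
          (taut 3 (λ r x x₂ → r ∧ x xor ((r xor (r ∧ x)) ∧ x₂))
                  (λ r x x₂ → r ∧ (x xor (not x ∧ x₂))) refl
                  (R e) (X (end e i)) (X₂ (end e i)))
        exactly-one : ExactlyOne K K₂ (A △ (K △ K₂))
        exactly-one e = exactly-one-rest (λ K₂e Ke → true≢false (saturated-⊆ {R △ K} {K₂} satK₂ e K₂e)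
          (△-disjoint {R} {K} (saturated-⊆ {R} {K} satK) e Ke))

      -- `connected-remainder` is used twice: `C₂` holds `K △ B` together and `C₁` holds `A △ K`
      -- together. Both are odd since `K` is even.
      even-component⇒decomposition : ∀ {C₂ K} → Circuit G C₂ → C₂ ⊆ K → Saturated R K →
        ConnectedSub G K → negParity K ≡ false → OddComponent (K △ C₂) → DecompThreeOddEulerian G
      even-component⇒decomposition {C₂} {K} circuit₂ C₂⊆K satK connK evenK (B , satB , connB , oddB) =
        decomposition B (K △ B) (A △ K)
          (connB , B-even , oddB)
          ( connected-remainder {K} {C₂} {B} connK (proj₂ (proj₂ circuit₂)) (proj₁ circuit₂) C₂⊆K satB
          , △-even {K} {B} K-even B-even , △-parity {K} {B} evenK oddB)
          (remainder-connected {K} satK , △-even {A} {K} even K-even , △-parity {A} {K} odd evenK)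
          exactly-one
        where
        K-even : EvenDegrees K
        K-even = saturated-even {R} {K} satK R-even
        B-even : EvenDegrees B
        B-even = saturated-even {K △ C₂} {B} satB
          (△-even {K} {C₂} K-even (circuit-even {C₂} circuit₂))
        exactly-one : ExactlyOne B (K △ B) (A △ K)
        exactly-one e = exactly-one-nested
          (λ Be → △-⊆ {K} {C₂} C₂⊆K e (saturated-⊆ {K △ C₂} {B} satB e Be))

    circuits⇒decomposition : TwoDisjointUnbalancedCircuits G → DecompThreeOddEulerian G
    circuits⇒decomposition
      (C₁ , C₂ , circuit₁ , circuit₂@((e₂ , C₂e₂) , _ , conn₂) , unbal₁ , unbal₂ , disjoint) =
      by-component (componentAt (A △ C₁) (s e₂))
      where
      odd₁ : negParity C₁ ≡ true
      odd₁ = Odd⇒negParity {C₁} unbal₁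
      odd₂ : negParity C₂ ≡ true
      odd₂ = Odd⇒negParity {C₂} unbal₂
      C₂⊆ : C₂ ⊆ A △ C₁
      C₂⊆ e C₂e = △-true {A} {C₁} e refl (exclusive-sym {C₁} {C₂} disjoint e C₂e)
      by-component : (Σ (EdgeSet G) λ K → Saturated (A △ C₁) K × ConnectedSub G K ×
                        (∀ e i → (A △ C₁) e ≡ true → Reach G (A △ C₁) (s e₂) (end e i) →
                          K e ≡ true)) →
                     DecompThreeOddEulerian G
      by-component (K , satK , connK , containsK) = by-parity (negParity K) refl
        where
        C₂⊆K : C₂ ⊆ K
        C₂⊆K e C₂e = containsK e zero (C₂⊆ e C₂e) (reach-mono {C₂} {A △ C₁} C₂⊆
          (conn₂ (s e₂) (s e) (incident {C₂} e₂ zero C₂e₂) (incident {C₂} e zero C₂e)))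
        by-parity : ∀ b → negParity K ≡ b → DecompThreeOddEulerian G
        by-parity true oddK = odd-component⇒decomposition {C₁} circuit₁ odd₁ {K} satK connK oddK
          (odd-component ((A △ C₁) △ K)
            (△-parity {A △ C₁} {K} (R-parity {C₁} circuit₁ odd₁) oddK))
        by-parity false evenK =
          even-component⇒decomposition {C₁} circuit₁ odd₁ {C₂} {K} circuit₂ C₂⊆K satK connK evenK
            (odd-component (K △ C₂) (△-parity {K} {C₂} evenK odd₂))

    -- `H` is the part that touches both others: joining it to each gives two connected sets, and
    -- the union of two disjoint odd sets is even.
    merge : ∀ {H H′ H″} → OddEulerian H → OddEulerian H′ → OddEulerian H″ →
            Exclusive H H′ → Exclusive H H″ →
            (∀ e → H e ≡ true ⊎ H′ e ≡ true ⊎ H″ e ≡ true) →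
            Touching H H′ → Touching H H″ → UnionTwoEvenEulerian G
    merge {H} {H′} {H″} (c , ev , o) (c′ , ev′ , o′) (c″ , ev″ , o″) excl′ excl″ cover touch′ touch″ =
      H △ H′ , H △ H″ ,
      (union H H′ c c′ excl′ touch′ , ∂⇒Even-deg {H △ H′} (△-even {H} {H′} ev ev′)) ,
      (union H H″ c c″ excl″ touch″ , ∂⇒Even-deg {H △ H″} (△-even {H} {H″} ev ev″)) ,
      negParity⇒Even {H △ H′} (△-parity {H} {H′} o o′) ,
      negParity⇒Even {H △ H″} (△-parity {H} {H″} o o″) , covered
      where
      ⊆ˡ : ∀ {P Q} → Exclusive P Q → P ⊆ P △ Q
      ⊆ˡ {P} {Q} excl e Pe = △-true {P} {Q} e Pe (excl e Pe)
      ⊆ʳ : ∀ {P Q} → Exclusive P Q → Q ⊆ P △ Q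
      ⊆ʳ {P} {Q} excl e Qe = trans (Bool.xor-comm (P e) (Q e))
        (△-true {Q} {P} e Qe (exclusive-sym {P} {Q} excl e Qe))
      union : ∀ P Q → ConnectedSub G P → ConnectedSub G Q → Exclusive P Q → Touching P Q →
              ConnectedSub G (P △ Q)
      union P Q cP cQ excl touch =
        union-connected {P} {Q} {P △ Q} cP cQ touch (⊆ˡ {P} {Q} excl) (⊆ʳ {P} {Q} excl) split
        where
        split : ∀ e → (P △ Q) e ≡ true → P e ≡ true ⊎ Q e ≡ true
        split e h with P e
        ... | true  = inj₁ refl
        ... | false = inj₂ h
      covered : ∀ e → (H △ H′) e ≡ true ⊎ (H △ H″) e ≡ true
      covered e with cover e
      ... | inj₁ He         = inj₁ (⊆ˡ {H} {H′} excl′ e He)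
      ... | inj₂ (inj₁ H′e) = inj₁ (⊆ʳ {H} {H′} excl′ e H′e)
      ... | inj₂ (inj₂ H″e) = inj₂ (⊆ʳ {H} {H″} excl″ e H″e)

    -- An instance of `cover-touching` for `H` and the union of the two other parts.
    touching-one : ∀ {H H′ H″} → NonEmpty H → NonEmpty H′ →
                   (∀ e → H e ≡ true ⊎ H′ e ≡ true ⊎ H″ e ≡ true) →
                   Touching H H′ ⊎ Touching H H″
    touching-one {H} {H′} {H″} nonempty (e′ , H′e′) cover
      with cover-touching {H} {λ e → H′ e ∨ H″ e} connected nonempty (e′ , cong (_∨ H″ e′) H′e′)
             (λ e → rest e (cover e))
      where
      rest : ∀ e → H e ≡ true ⊎ H′ e ≡ true ⊎ H″ e ≡ true → H e ≡ true ⊎ H′ e ∨ H″ e ≡ true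
      rest e (inj₁ He)         = inj₁ He
      rest e (inj₂ (inj₁ H′e)) = inj₂ (cong (_∨ H″ e) H′e)
      rest e (inj₂ (inj₂ H″e)) = inj₂ (∨-introʳ (H′ e) H″e)
    ... | x , incH , (e , i , h , refl) with H′ e in H′e
    ... | true  = inj₁ (x , incH , incident {H′} e i H′e)
    ... | false = inj₂ (x , incH , incident {H″} e i h)

    touching-sym : ∀ {P Q} → Touching P Q → Touching Q P
    touching-sym (x , p , q) = x , q , p

    decomposition⇒union : DecompThreeOddEulerian G → UnionTwoEvenEulerian G
    decomposition⇒union
      (H₁ , H₂ , H₃ , (c₁ , e₁) , (c₂ , e₂) , (c₃ , e₃) , o₁ , o₂ , o₃ , exactly-one) =
      choose (touching-one {H₁} {H₂} {H₃} (nonempty oe₁) (nonempty oe₂) cover)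
             (touching-one {H₂} {H₁} {H₃} (nonempty oe₂) (nonempty oe₁) cover₂)
             (touching-one {H₃} {H₁} {H₂} (nonempty oe₃) (nonempty oe₁) cover₃)
      where
      oe₁ : OddEulerian H₁
      oe₁ = c₁ , Even-deg⇒∂ {H₁} e₁ , Odd⇒negParity {H₁} o₁
      oe₂ : OddEulerian H₂
      oe₂ = c₂ , Even-deg⇒∂ {H₂} e₂ , Odd⇒negParity {H₂} o₂
      oe₃ : OddEulerian H₃
      oe₃ = c₃ , Even-deg⇒∂ {H₃} e₃ , Odd⇒negParity {H₃} o₃
      nonempty : ∀ {H} → OddEulerian H → NonEmpty H
      nonempty {H} (_ , _ , o) = odd⇒NonEmpty {H} o
      cover : ∀ e → H₁ e ≡ true ⊎ H₂ e ≡ true ⊎ H₃ e ≡ true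
      cover e with exactly-one e
      ... | inj₁ (h , _)            = inj₁ h
      ... | inj₂ (inj₁ (_ , h , _)) = inj₂ (inj₁ h)
      ... | inj₂ (inj₂ (_ , _ , h)) = inj₂ (inj₂ h)
      cover₂ : ∀ e → H₂ e ≡ true ⊎ H₁ e ≡ true ⊎ H₃ e ≡ true
      cover₂ e with cover e
      ... | inj₁ h        = inj₂ (inj₁ h)
      ... | inj₂ (inj₁ h) = inj₁ h
      ... | inj₂ (inj₂ h) = inj₂ (inj₂ h)
      cover₃ : ∀ e → H₃ e ≡ true ⊎ H₁ e ≡ true ⊎ H₂ e ≡ true
      cover₃ e with cover e
      ... | inj₁ h        = inj₂ (inj₁ h)
      ... | inj₂ (inj₁ h) = inj₂ (inj₂ h)
      ... | inj₂ (inj₂ h) = inj₁ h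
      excl₁₂ : Exclusive H₁ H₂
      excl₁₂ e h with exactly-one e
      ... | inj₁ (_ , g , _)        = g
      ... | inj₂ (inj₁ (g , _))     = contradiction g (true≢false h)
      ... | inj₂ (inj₂ (_ , g , _)) = g
      excl₁₃ : Exclusive H₁ H₃
      excl₁₃ e h with exactly-one e
      ... | inj₁ (_ , _ , g)        = g
      ... | inj₂ (inj₁ (_ , _ , g)) = g
      ... | inj₂ (inj₂ (g , _))     = contradiction g (true≢false h)
      excl₂₃ : Exclusive H₂ H₃
      excl₂₃ e h with exactly-one e
      ... | inj₁ (_ , _ , g)        = g
      ... | inj₂ (inj₁ (_ , _ , g)) = g
      ... | inj₂ (inj₂ (_ , g , _)) = contradiction g (true≢false h)
      excl₂₁ : Exclusive H₂ H₁
      excl₂₁ = exclusive-sym {H₁} {H₂} excl₁₂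
      excl₃₁ : Exclusive H₃ H₁
      excl₃₁ = exclusive-sym {H₁} {H₃} excl₁₃
      excl₃₂ : Exclusive H₃ H₂
      excl₃₂ = exclusive-sym {H₂} {H₃} excl₂₃
      merge₁ : Touching H₁ H₂ → Touching H₁ H₃ → UnionTwoEvenEulerian G
      merge₁ = merge {H₁} {H₂} {H₃} oe₁ oe₂ oe₃ excl₁₂ excl₁₃ cover
      merge₂ : Touching H₂ H₁ → Touching H₂ H₃ → UnionTwoEvenEulerian G
      merge₂ = merge {H₂} {H₁} {H₃} oe₂ oe₁ oe₃ excl₂₁ excl₂₃ cover₂
      merge₃ : Touching H₃ H₁ → Touching H₃ H₂ → UnionTwoEvenEulerian G
      merge₃ = merge {H₃} {H₁} {H₂} oe₃ oe₁ oe₂ excl₃₁ excl₃₂ cover₃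
      -- A graph on three vertices without isolated vertices has a vertex adjacent to both others.
      choose : Touching H₁ H₂ ⊎ Touching H₁ H₃ → Touching H₂ H₁ ⊎ Touching H₂ H₃ →
               Touching H₃ H₁ ⊎ Touching H₃ H₂ → UnionTwoEvenEulerian G
      choose (inj₁ t₁₂) _          (inj₁ t₃₁) = merge₁ t₁₂ (touching-sym {H₃} {H₁} t₃₁)
      choose (inj₁ t₁₂) _          (inj₂ t₃₂) =
        merge₂ (touching-sym {H₁} {H₂} t₁₂) (touching-sym {H₃} {H₂} t₃₂)
      choose (inj₂ t₁₃) (inj₁ t₂₁) _          = merge₁ (touching-sym {H₂} {H₁} t₂₁) t₁₃
      choose (inj₂ t₁₃) (inj₂ t₂₃) _          =
        merge₃ (touching-sym {H₁} {H₃} t₁₃) (touching-sym {H₂} {H₃} t₂₃)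

    disjoint-odd⇒circuits : ∀ {A B} → EvenDegrees A → EvenDegrees B →
      negParity A ≡ true → negParity B ≡ true → Exclusive A B → TwoDisjointUnbalancedCircuits G
    disjoint-odd⇒circuits {A} {B} evenA evenB oddA oddB excl
      with odd-circuit (suc (count A)) A ℕ.≤-refl evenA oddA
         | odd-circuit (suc (count B)) B ℕ.≤-refl evenB oddB
    ... | C₁ , circuit₁ , odd₁ , C₁⊆A | C₂ , circuit₂ , odd₂ , C₂⊆B =
      C₁ , C₂ , circuit₁ , circuit₂ , negParity⇒Odd {C₁} odd₁ , negParity⇒Odd {C₂} odd₂ , disjoint
      where
      disjoint : Exclusive C₁ C₂
      disjoint e C₁e with C₂ e in C₂e
      ... | false = refl
      ... | true  = contradiction (excl e (C₁⊆A e C₁e)) (true≢false (C₂⊆B e C₂e))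

    -- The complement of H₂ is the part of H₁ outside H₂, and vice versa.
    union⇒circuits : UnionTwoEvenEulerian G → TwoDisjointUnbalancedCircuits G
    union⇒circuits (H₁ , H₂ , (_ , e₁) , (_ , e₂) , n₁ , n₂ , cover) =
      disjoint-odd⇒circuits {allEdges G △ H₂} {allEdges G △ H₁}
        (△-even {allEdges G} {H₂} even (Even-deg⇒∂ {H₂} e₂))
        (△-even {allEdges G} {H₁} even (Even-deg⇒∂ {H₁} e₁))
        (△-parity {allEdges G} {H₂} odd (Even⇒negParity {H₂} n₂))
        (△-parity {allEdges G} {H₁} odd (Even⇒negParity {H₁} n₁)) exclusive
      where
      exclusive : Exclusive (allEdges G △ H₂) (allEdges G △ H₁)
      exclusive e h with H₁ e | H₂ e | cover e
      ... | true  | _     | _      = refl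
      ... | false | true  | _      = contradiction (sym h) (λ ())
      ... | false | false | inj₁ ()
      ... | false | false | inj₂ ()

    flow⇒circuits : HasNZFlow G → TwoDisjointUnbalancedCircuits G
    flow⇒circuits flow
      with disjoint-odd-cycles (suc (count (nonloop s t))) s t neg ℕ.≤-refl even odd
             (NZFlow⇒NoSingle flow)
    ... | A , B , evenA , evenB , oddA , oddB , disjoint =
      disjoint-odd⇒circuits {A} {B} evenA evenB oddA oddB
        (λ e Ae → trans (sym (cong (_∧ B e) Ae)) (disjoint e))

-- Euler trails and the flows along them

flip-cases : ∀ i j → i ≡ j ⊎ i ≡ flip j
flip-cases zero       zero       = inj₁ refl
flip-cases zero       (suc zero) = inj₂ refl
flip-cases (suc zero) zero       = inj₂ refl
flip-cases (suc zero) (suc zero) = inj₁ refl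

when : Bool → ℤ → ℤ
when b x = if b then x else 0ℤ

oriented-+ : ∀ o x y → oriented o (x ℤ.+ y) ≡ oriented o x ℤ.+ oriented o y
oriented-+ true  x y = refl
oriented-+ false x y = ℤ.neg-distrib-+ x y

oriented-0 : ∀ o → oriented o 0ℤ ≡ 0ℤ
oriented-0 true  = refl
oriented-0 false = refl

oriented-∘ : ∀ a b x → oriented (not a) (oriented (not b) x) ≡ oriented (not (b xor a)) x
oriented-∘ false false x = refl
oriented-∘ false true  x = refl
oriented-∘ true  false x = refl
oriented-∘ true  true  x = ℤ.neg-involutive x

oriented-involutive : ∀ o x → oriented o (oriented o x) ≡ x
oriented-involutive true  x = refl
oriented-involutive false x = ℤ.neg-involutive x

when-+ : ∀ b x y → when b (x ℤ.+ y) ≡ when b x ℤ.+ when b y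
when-+ true  x y = refl
when-+ false x y = refl

when-0 : ∀ b → when b 0ℤ ≡ 0ℤ
when-0 true  = refl
when-0 false = refl

IsUnit : ℤ → Set
IsUnit x = x ≡ 1ℤ ⊎ x ≡ -1ℤ

oriented-unit : ∀ o {x} → IsUnit x → IsUnit (oriented o x)
oriented-unit true  u           = u
oriented-unit false (inj₁ refl) = inj₂ refl
oriented-unit false (inj₂ refl) = inj₁ refl

module EulerTrails (G : SignedGraph) where
  open Decompositions G public

  _++_ : ∀ {u v w} → Walk u v → Walk v w → Walk u w
  []              ++ Y = Y
  step e i eq W ++ Y = step e i eq (W ++ Y)

  mult-++ : ∀ {u v w} (W : Walk u v) (Y : Walk v w) e → mult (W ++ Y) e ≡ mult W e ℕ.+ mult Y e
  mult-++ []               Y x = refl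
  mult-++ (step e i eq W) Y x = trans (cong (half (e == x) ℕ.+_) (mult-++ W Y x))
                                      (sym (ℕ.+-assoc (half (e == x)) (mult W x) (mult Y x)))

  On : ∀ {u w} → Fin nV → Walk u w → Set
  On {u} x []              = x ≡ u
  On {u} x (step _ _ _ W) = x ≡ u ⊎ On x W

  on-start : ∀ {u w} (W : Walk u w) → On u W
  on-start []             = refl
  on-start (step _ _ _ _) = inj₁ refl

  on-edge : ∀ {u w} (W : Walk u w) e i → mult W e ≢ 0 → On (end e i) W
  on-edge []                 e i h = contradiction refl h
  on-edge (step e′ j refl W) e i h with e′ ≟ e
  ... | no _ = inj₂ (on-edge W e i h)
  ... | yes refl with flip-cases i j
  ...   | inj₁ refl = inj₁ refl
  ...   | inj₂ refl = inj₂ (on-start W)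

  splice : ∀ {u w x} (W : Walk u w) → On x W → Walk x x → Walk u w
  splice []              refl        Y = Y
  splice (step e i eq W) (inj₁ refl) Y = Y ++ step e i eq W
  splice (step e i eq W) (inj₂ on)   Y = step e i eq (splice W on Y)

  mult-splice : ∀ {u w x} (W : Walk u w) (on : On x W) (Y : Walk x x) e →
                mult (splice W on Y) e ≡ mult W e ℕ.+ mult Y e
  mult-splice []              refl        Y e = refl
  mult-splice (step f i eq W) (inj₁ refl) Y e =
    trans (mult-++ Y (step f i eq W) e) (ℕ.+-comm (mult Y e) (mult (step f i eq W) e))
  mult-splice (step f i eq W) (inj₂ on)   Y e =
    trans (cong (half (f == e) ℕ.+_) (mult-splice W on Y e))
          (sym (ℕ.+-assoc (half (f == e)) (mult W e) (mult Y e)))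

  within-splice : ∀ {u w x R} (W : Walk u w) (on : On x W) (Y : Walk x x) →
                  Within W R → Within Y (R △ trace W) → Within (splice W on Y) R
  within-splice {R = R} W on Y withinW withinY e = subst (_≤ half (R e)) (sym (mult-splice W on Y e))
    (bound (R e) (mult W e) (mult Y e) (withinW e) (withinY e))
    where
    bound : ∀ r m n → m ≤ half r → n ≤ half (r xor parity m) → m ℕ.+ n ≤ half r
    bound r     zero          n _        hn = subst (λ b → n ≤ half b) (Bool.xor-identityʳ r) hn
    bound true  (suc zero)    n _        hn = s≤s hn
    bound true  (suc (suc _)) n (s≤s ()) _

  trace-splice : ∀ {u w x} (W : Walk u w) (on : On x W) (Y : Walk x x) e →
                 trace (splice W on Y) e ≡ trace W e xor trace Y e
  trace-splice W on Y e = trans (cong parity (mult-splice W on Y e)) (parity-+ (mult W e) (mult Y e))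

  trail-NonEmpty : ∀ {R u w x} (W : Walk u w) → Within W R → visits W x ≡ 2 → NonEmpty (trace W)
  trail-NonEmpty {x = x} W within visits-x
    with deg≢0⇒Incident (trace W) x
           (λ h → contradiction (trans (sym visits-x) (trans (sym (deg-trace W within x)) h)) (λ ()))
  ... | e , _ , We , _ = e , We

  trace-even : ∀ {u} (W : Walk u u) → EvenDegrees (trace W)
  trace-even {u} W x = trans (∂-trace W x) (Bool.xor-same (u == x))

  meeting-edge : ∀ {H u} (W : Walk u u) → (∀ v → Incident G H v → Reach G H u v) →
    Within W H → ∀ e → (H △ trace W) e ≡ true →
    Σ (Fin nE) λ f → Σ (Fin 2) λ i → (H △ trace W) f ≡ true × On (end f i) W
  meeting-edge {H} {u} W reach within e rest-e = conclude (explore (reach (s e) (incident {H} e zero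
      (△-⊆ {H} {trace W} (trace-⊆ W within) e rest-e))))
    where
    Meeting : Set
    Meeting = Σ (Fin nE) λ f → Σ (Fin 2) λ i → (H △ trace W) f ≡ true × On (end f i) W
    explore : ∀ {y} → Reach G H u y → Meeting ⊎ On y W
    explore here = inj₂ (on-start W)
    explore (step {f} i j Hf r) = extend (explore r) ((H △ trace W) f) refl
      where
      extend : Meeting ⊎ On (end f i) W → ∀ b → (H △ trace W) f ≡ b → Meeting ⊎ On (end f j) W
      extend (inj₁ meeting) _     _      = inj₁ meeting
      extend (inj₂ on)      true  rest-f = inj₁ (f , i , rest-f , on)
      extend (inj₂ on)      false rest-f = inj₂ (on-edge W f j (λ mult≡0 →
        true≢false (trans (cong₂ _xor_ Hf (cong parity mult≡0)) refl) rest-f))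
    conclude : Meeting ⊎ On (s e) W → Meeting
    conclude (inj₁ meeting) = meeting
    conclude (inj₂ on)      = e , zero , rest-e , on

  EulerTrail : EdgeSet G → Fin nV → Set
  EulerTrail H u = Σ (Walk u u) λ W → ∀ e → mult W e ≡ half (H e)

  euler-trail : ∀ bound {H u} → EvenDegrees H → (∀ v → Incident G H v → Reach G H u v) →
    (W : Walk u u) → Within W H → count (H △ trace W) < bound → EulerTrail H u
  euler-trail (suc bound) {H} {u} even reach W within (s≤s size) =
    finish (any? (λ e → (H △ trace W) e Bool.≟ true))
    where
    extend : ∀ f i → On (end f i) W →
             Σ (Walk (end f i) (end f i)) (λ Y → Within Y (H △ trace W) × visits Y (end f i) ≡ 2) →
             EulerTrail H u
    extend f i on (Y , withinY , visitsY) = euler-trail bound {H} {u} even reach (splice W on Y)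
      (within-splice {R = H} W on Y within withinY) (ℕ.≤-<-trans (count-mono rest⊆) smaller)
      where
      smaller : count ((H △ trace W) △ trace Y) < bound
      smaller = ℕ.<-≤-trans (△-smaller {H △ trace W} {trace Y}
        (trace-⊆ Y withinY) (trail-NonEmpty Y withinY visitsY)) size
      rest⊆ : ∀ e → (H △ trace (splice W on Y)) e ≡ true → ((H △ trace W) △ trace Y) e ≡ true
      rest⊆ e h = trans (Bool.xor-assoc (H e) (trace W e) (trace Y e))
        (trans (cong (H e xor_) (sym (trace-splice W on Y e))) h)
    meet : (Σ (Fin nE) λ f → Σ (Fin 2) λ i → (H △ trace W) f ≡ true × On (end f i) W) →
           EulerTrail H u
    meet (f , i , rest-f , on) = extend f i on (closed-trail {H △ trace W}
      (△-even {H} {trace W} even (trace-even W)) f i rest-f)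
    finish : Dec (Σ (Fin nE) λ e → (H △ trace W) e ≡ true) → EulerTrail H u
    finish (yes (e , rest-e)) = meet (meeting-edge {H} {u} W reach within e rest-e)
    finish (no none) = W , λ e → trans (sym (within⇒mult W within e))
      (cong half (sym (equal (H e) (trace W e) (λ h → none (e , h)))))
      where
      equal : ∀ a b → a xor b ≢ true → a ≡ b
      equal true  true  _ = refl
      equal true  false h = contradiction refl h
      equal false true  h = contradiction refl h
      equal false false _ = refl

  -- One orientation for all flows, so that flows can be added edge by edge; directions of travel go
  -- into the signs of the values.
  τ : Orientation G
  τ e zero    = true
  τ e (suc _) = neg e

  τ-valid : ValidOrientation G τ
  τ-valid e with neg e
  ... | true  = refl
  ... | false = λ ()

  -- The trailing zero makes this definitionally the inner sum of `netFlow`.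
  flux : Fin nE → Fin nV → ℤ → ℤ
  flux e v x = when (s e == v) (oriented (τ e zero) x) ℤ.+
               (when (t e == v) (oriented (τ e (suc zero)) x) ℤ.+ 0ℤ)

  flux-end : ∀ e i v x → flux e v x ≡ when (end e i == v) (oriented (τ e i) x) ℤ.+
                                      when (end e (flip i) == v) (oriented (τ e (flip i)) x)
  flux-end e zero v x = cong (λ q → when (s e == v) x ℤ.+ q) (ℤ.+-identityʳ _)
  flux-end e (suc zero) v x = trans (cong (λ q → when (s e == v) x ℤ.+ q)
                                          (ℤ.+-identityʳ (when (t e == v) (oriented (neg e) x))))
                                    (ℤ.+-comm (when (s e == v) x)
                                              (when (t e == v) (oriented (neg e) x)))

  flux-+ : ∀ e v x y → flux e v (x ℤ.+ y) ≡ flux e v x ℤ.+ flux e v y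
  flux-+ e v x y = begin
      flux e v (x ℤ.+ y)
    ≡⟨ flux-end e zero v (x ℤ.+ y) ⟩
      when a (x ℤ.+ y) ℤ.+ when b (oriented o (x ℤ.+ y))
    ≡⟨ cong₂ ℤ._+_ (when-+ a x y) (trans (cong (when b) (oriented-+ o x y)) (when-+ b _ _)) ⟩
      (when a x ℤ.+ when a y) ℤ.+ (when b (oriented o x) ℤ.+ when b (oriented o y))
    ≡⟨ Semigroup.interchange ℤ.+-commutativeSemigroup (when a x) (when a y) _ _ ⟩
      (when a x ℤ.+ when b (oriented o x)) ℤ.+ (when a y ℤ.+ when b (oriented o y))
    ≡⟨ sym (cong₂ ℤ._+_ (flux-end e zero v x) (flux-end e zero v y)) ⟩
      flux e v x ℤ.+ flux e v y ∎
    where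
    open ≡-Reasoning
    a b o : Bool
    a = s e == v
    b = t e == v
    o = neg e

  flux-0 : ∀ e v → flux e v 0ℤ ≡ 0ℤ
  flux-0 e v = trans (flux-end e zero v 0ℤ) (cong₂ ℤ._+_ (when-0 (s e == v))
    (trans (cong (when (t e == v)) (oriented-0 (neg e))) (when-0 (t e == v))))

  net : (Fin nE → ℤ) → Fin nV → ℤ
  net ξ v = ∑ (λ e → flux e v (ξ e))

  netFlow≡net : ∀ ξ v → netFlow G τ ξ v ≡ net ξ v
  netFlow≡net ξ v = sumℤ≡∑ (λ e → flux e v (ξ e))

  net-+ : ∀ ξ ζ v → net (λ e → ξ e ℤ.+ ζ e) v ≡ net ξ v ℤ.+ net ζ v
  net-+ ξ ζ v = trans (∑-cong (λ e → flux-+ e v (ξ e) (ζ e)))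
                      (∑-+ (λ e → flux e v (ξ e)) (λ e → flux e v (ζ e)))

  turn : Fin nE → ℤ → ℤ
  turn e σ = oriented (not (neg e)) σ

  -- The flow sent along a walk that leaves its start with value σ; the value changes sign at each
  -- negative edge.
  along : ∀ {u w} → Walk u w → ℤ → Fin nE → ℤ
  along []             σ x = 0ℤ
  along (step e i _ W) σ x = when (e == x) (oriented (τ e i) σ) ℤ.+ along W (turn e σ) x

  final : ∀ {u w} → Walk u w → ℤ → ℤ
  final []             σ = σ
  final (step e _ _ W) σ = final W (turn e σ)

  -- What arrives at the far end is what the walk sends on in its next step, so contributions along
  -- the walk telescope in `net-along`.
  far-end : ∀ e i σ → oriented (τ e (flip i)) (oriented (τ e i) σ) ≡ - turn e σ
  far-end e zero σ with neg e
  ... | true  = sym (ℤ.neg-involutive σ)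
  ... | false = refl
  far-end e (suc zero) σ with neg e
  ... | true  = sym (ℤ.neg-involutive σ)
  ... | false = refl

  net-single : ∀ e c v → net (λ x → when (e == x) c) v ≡ flux e v c
  net-single e c v = trans
    (∑-single (λ x → flux x v (when (e == x) c)) e
      (λ x e≢x → trans (cong (λ b → flux x v (when b c)) (==-≢ e≢x)) (flux-0 x v)))
    (cong (λ b → flux e v (when b c)) (==-refl e))

  net-along : ∀ {u w} (W : Walk u w) σ v →
              net (along W σ) v ≡ when (u == v) σ ℤ.+ when (w == v) (- final W σ)
  net-along {u} [] σ v = trans (∑-zero (λ e → flux e v 0ℤ) (λ e → flux-0 e v)) (sym (cancel (u == v)))
    where
    cancel : ∀ b → when b σ ℤ.+ when b (- σ) ≡ 0ℤ
    cancel true  = ℤ.+-inverseʳ σ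
    cancel false = refl
  net-along {w = w} (step e i refl W) σ v = begin
      net (along (step e i refl W) σ) v
    ≡⟨ net-+ (λ x → when (e == x) (oriented (τ e i) σ)) (along W (turn e σ)) v ⟩
      net (λ x → when (e == x) (oriented (τ e i) σ)) v ℤ.+ net (along W (turn e σ)) v
    ≡⟨ cong₂ ℤ._+_ (net-single e (oriented (τ e i) σ) v) (net-along W (turn e σ) v) ⟩
      flux e v (oriented (τ e i) σ) ℤ.+ (when y (turn e σ) ℤ.+ z)
    ≡⟨ cong (ℤ._+ (when y (turn e σ) ℤ.+ z)) (trans (flux-end e i v (oriented (τ e i) σ))
         (cong₂ (λ p q → when (end e i == v) p ℤ.+ when y q)
                (oriented-involutive (τ e i) σ) (far-end e i σ))) ⟩
      (when (end e i == v) σ ℤ.+ when y (- turn e σ)) ℤ.+ (when y (turn e σ) ℤ.+ z)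
    ≡⟨ ℤ.+-assoc (when (end e i == v) σ) _ _ ⟩
      when (end e i == v) σ ℤ.+ (when y (- turn e σ) ℤ.+ (when y (turn e σ) ℤ.+ z))
    ≡⟨ cong (λ q → when (end e i == v) σ ℤ.+ q) (trans (sym (ℤ.+-assoc (when y (- turn e σ)) _ z))
         (trans (cong (ℤ._+ z) (cancel y (turn e σ))) (ℤ.+-identityˡ z))) ⟩
      when (end e i == v) σ ℤ.+ z ∎
    where
    open ≡-Reasoning
    y : Bool
    y = end e (flip i) == v
    z : ℤ
    z = when (w == v) (- final W (turn e σ))
    cancel : ∀ b x → when b (- x) ℤ.+ when b x ≡ 0ℤ
    cancel true  x = ℤ.+-inverseˡ x
    cancel false x = refl

  negParity-trace-step : ∀ {u w} e i eq (W : Walk (end e (flip i)) w) →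
    negParity (trace (step {u} e i eq W)) ≡ neg e xor negParity (trace W)
  negParity-trace-step e i eq W = trans
    (negParity-cong {trace (step e i eq W)} {(e ==_) △ trace W} (λ y →
      trans (parity-+ (half (e == y)) (mult W y)) (cong (_xor trace W y) (parity-half (e == y)))))
    (△-parity {e ==_} {trace W}
      (trans (⨁-cong (λ x → Bool.∧-comm (e == x) (neg x))) (⨁-evaluate neg e)) refl)

  -- The value changes sign once per negative step. With an even number of these, a closed walk
  -- returns with its initial value and so carries a flow.
  final-parity : ∀ {u w} (W : Walk u w) σ → final W σ ≡ oriented (not (negParity (trace W))) σ
  final-parity [] σ =
    cong (λ b → oriented (not b) σ) (sym (⨁-zero {nE} (λ _ → false) (λ _ → refl)))
  final-parity (step e i eq W) σ = trans (final-parity W (turn e σ))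
    (trans (oriented-∘ (negParity (trace W)) (neg e) σ)
           (cong (λ b → oriented (not b) σ) (sym (negParity-trace-step e i eq W))))

  along-absent : ∀ {u w} (W : Walk u w) σ x → mult W x ≡ 0 → along W σ x ≡ 0ℤ
  along-absent []              σ x _ = refl
  along-absent (step e i eq W) σ x h with e ≟ x
  ... | no _ = trans (ℤ.+-identityˡ _) (along-absent W (turn e σ) x h)

  along-unit : ∀ {u w} (W : Walk u w) {σ} → IsUnit σ → ∀ x → mult W x ≡ 1 → IsUnit (along W σ x)
  along-unit (step e i eq W) {σ} unit x h with e ≟ x
  ... | no _     = subst IsUnit (sym (ℤ.+-identityˡ _))
    (along-unit W (oriented-unit (not (neg e)) unit) x h)
  ... | yes refl = subst IsUnit
    (sym (trans (cong (λ q → oriented (τ e i) σ ℤ.+ q)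
                      (along-absent W (turn e σ) e (ℕ.suc-injective h)))
                (ℤ.+-identityʳ _)))
    (oriented-unit (τ e i) unit)

  UnitFlow : EdgeSet G → Set
  UnitFlow H = Σ (Fin nE → ℤ) λ ξ → (∀ v → net ξ v ≡ 0ℤ) ×
    (∀ e → H e ≡ true → IsUnit (ξ e)) × (∀ e → H e ≡ false → ξ e ≡ 0ℤ)

  even-eulerian⇒unit-flow : ∀ {H} → EulerianSub G H → Even (negCount G H) → UnitFlow H
  even-eulerian⇒unit-flow {H} (connected , even-deg) even = by-edge (any? (λ e → H e Bool.≟ true))
    where
    from-trail : ∀ {u} → EulerTrail H u → UnitFlow H
    from-trail {u} (W , covers) = along W 1ℤ , balanced ,
      (λ e He → along-unit W (inj₁ refl) e (trans (covers e) (cong half He))) ,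
      (λ e He → along-absent W 1ℤ e (trans (covers e) (cong half He)))
      where
      W-even : negParity (trace W) ≡ false
      W-even = trans (negParity-cong {trace W} {H}
                 (λ e → trans (cong parity (covers e)) (parity-half (H e)))) (Even⇒negParity {H} even)
      balanced : ∀ v → net (along W 1ℤ) v ≡ 0ℤ
      balanced v = trans (net-along W 1ℤ v)
        (trans (cong (λ x → when (u == v) 1ℤ ℤ.+ when (u == v) (- x))
                     (trans (final-parity W 1ℤ) (cong (λ b → oriented (not b) 1ℤ) W-even)))
               (cancel (u == v)))
        where
        cancel : ∀ b → when b 1ℤ ℤ.+ when b (- 1ℤ) ≡ 0ℤ
        cancel true  = refl
        cancel false = refl
    by-edge : Dec (Σ (Fin nE) λ e → H e ≡ true) → UnitFlow H
    -- An empty `H` offers no start vertex for a trail; the zero flow serves instead.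
    by-edge (no none) = (λ _ → 0ℤ) , (λ v → ∑-zero (λ e → flux e v 0ℤ) (λ e → flux-0 e v)) ,
      (λ e He → contradiction (e , He) none) , (λ _ _ → refl)
    by-edge (yes (e , He)) = from-trail (euler-trail (suc (count (H △ trace {s e} []))) {H} {s e}
      (Even-deg⇒∂ {H} even-deg) (λ v inc → connected (s e) v (incident {H} e zero He) inc)
      [] (λ _ → z≤n) ℕ.≤-refl)

  -- With both summands in -1, 0, 1, the value of `ξ₁ + 2 ξ₂` lies between -3 and 3 and is zero only
  -- where both vanish, which the cover excludes. The double is written as a sum so that `net-+`
  -- applies.
  union⇒4-flow : UnionTwoEvenEulerian G → HasNZkFlow G 4
  union⇒4-flow (H₁ , H₂ , euler₁ , euler₂ , even₁ , even₂ , cover)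
    = combine (even-eulerian⇒unit-flow {H₁} euler₁ even₁) (even-eulerian⇒unit-flow {H₂} euler₂ even₂)
    where
    small : ∀ a b {x y} → (a ≡ true → IsUnit x) → (a ≡ false → x ≡ 0ℤ) →
            (b ≡ true → IsUnit y) → (b ≡ false → y ≡ 0ℤ) → a ≡ true ⊎ b ≡ true →
            x ℤ.+ (y ℤ.+ y) ≢ 0ℤ × ∣ x ℤ.+ (y ℤ.+ y) ∣ < 4
    small false false _ _ _ _ (inj₁ ())
    small false false _ _ _ _ (inj₂ ())
    small true false x-unit _ _ y-zero _ with x-unit refl | y-zero refl
    ... | inj₁ refl | refl = (λ ()) , s≤s (s≤s z≤n)
    ... | inj₂ refl | refl = (λ ()) , s≤s (s≤s z≤n)
    small false true _ x-zero y-unit _ _ with x-zero refl | y-unit refl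
    ... | refl | inj₁ refl = (λ ()) , s≤s (s≤s (s≤s z≤n))
    ... | refl | inj₂ refl = (λ ()) , s≤s (s≤s (s≤s z≤n))
    small true true x-unit _ y-unit _ _ with x-unit refl | y-unit refl
    ... | inj₁ refl | inj₁ refl = (λ ()) , s≤s (s≤s (s≤s (s≤s z≤n)))
    ... | inj₁ refl | inj₂ refl = (λ ()) , s≤s (s≤s z≤n)
    ... | inj₂ refl | inj₁ refl = (λ ()) , s≤s (s≤s z≤n)
    ... | inj₂ refl | inj₂ refl = (λ ()) , s≤s (s≤s (s≤s (s≤s z≤n)))
    combine : UnitFlow H₁ → UnitFlow H₂ → HasNZkFlow G 4
    combine (ξ₁ , flow₁ , unit₁ , zero₁) (ξ₂ , flow₂ , unit₂ , zero₂) =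
      τ , τ-valid , (λ e → ξ₁ e ℤ.+ (ξ₂ e ℤ.+ ξ₂ e)) , flow ,
      (λ e → small (H₁ e) (H₂ e) (unit₁ e) (zero₁ e) (unit₂ e) (zero₂ e) (cover e))
      where
      flow : IsFlow G τ (λ e → ξ₁ e ℤ.+ (ξ₂ e ℤ.+ ξ₂ e))
      flow v = trans (netFlow≡net (λ e → ξ₁ e ℤ.+ (ξ₂ e ℤ.+ ξ₂ e)) v)
        (trans (net-+ ξ₁ (λ e → ξ₂ e ℤ.+ ξ₂ e) v)
               (cong₂ ℤ._+_ (flow₁ v) (trans (net-+ ξ₂ ξ₂ v) (cong₂ ℤ._+_ (flow₂ v) (flow₂ v)))))

-- The implications assembled into equivalences

theorem9 : (G : SignedGraph) → EulerianGraph G → Odd (negCount G (allEdges G)) →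
    (HasNZFlow G ⇔ HasNZkFlow G 4) × (HasNZkFlow G 4 ⇔ TwoDisjointUnbalancedCircuits G) ×
    (TwoDisjointUnbalancedCircuits G ⇔ UnionTwoEvenEulerian G) ×
    (UnionTwoEvenEulerian G ⇔ DecompThreeOddEulerian G)
theorem9 G (connected , even-deg) odd-neg =
  -- Everything is composed from (a) ⇒ (c) ⇒ (e) ⇒ (d), from (d) back to (c) and on to (b), and from
  -- the trivial (b) ⇒ (a).
  mk⇔ (c⇒b ∘ a⇒c) b⇒a , mk⇔ (a⇒c ∘ b⇒a) c⇒b , mk⇔ c⇒d d⇒c , mk⇔ (c⇒e ∘ d⇒c) e⇒d
  where
  open EulerTrails G
  even : EvenDegrees (allEdges G)
  even = Even-deg⇒∂ {allEdges G} even-deg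
  odd : negParity (allEdges G) ≡ true
  odd = Odd⇒negParity {allEdges G} odd-neg
  a⇒c : HasNZFlow G → TwoDisjointUnbalancedCircuits G
  a⇒c = flow⇒circuits connected even odd
  c⇒e : TwoDisjointUnbalancedCircuits G → DecompThreeOddEulerian G
  c⇒e = circuits⇒decomposition connected even odd
  e⇒d : DecompThreeOddEulerian G → UnionTwoEvenEulerian G
  e⇒d = decomposition⇒union connected even odd
  d⇒c : UnionTwoEvenEulerian G → TwoDisjointUnbalancedCircuits G
  d⇒c = union⇒circuits connected even odd
  c⇒d : TwoDisjointUnbalancedCircuits G → UnionTwoEvenEulerian G
  c⇒d = e⇒d ∘ c⇒e
  c⇒b : TwoDisjointUnbalancedCircuits G → HasNZkFlow G 4
  c⇒b = union⇒4-flow ∘ c⇒d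
  b⇒a : HasNZkFlow G 4 → HasNZFlow G
  b⇒a (τ , valid , ξ , flow , bounded) = τ , valid , ξ , flow , proj₁ ∘ bounded
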